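{- Let $$c=1-19x+16x^2,\quad d=1-5x,\quad g=1-32x,\quad a=\tfrac52-8x,\quad b=\tfrac32,$$ $$y^{+}=\frac{2x^2}{c+d\sqrt g},\qquad y^{ - }=\frac{2x^2}{c-d\sqrt g}.$$ Then $$\left(\frac{c^2-d^2g}{4x}\right)^{1/3}=\left(\frac{a^2-b^2g}{4}\right)^{1/2}=1+4x,$$ $$y^+=x^2+O(x^3)\quad\text{and}\quad y^-=x+O(x^2)\quad\text{as } x\to0,$$ and in a neighbourhood of $x=0$ $$F_6(x)=\frac{2}{(a+b\sqrt g)^{1/2}}F_3(y^+)=\frac{1}{(a-b\sqrt g)^{1/2}}F_3(y^-),$$ where $F_3$ and $F_6$ are the power series defined in the context.
   Context: Here $q=e^{2\pi i\tau}$ with $\operatorname{Im}\tau>0$ and $\eta_m=q^{m/24}\prod_{j\ge1}(1-q^{mj})$. Roots are taken with the branch that is positive at $x=0$, and fractional powers of $q$-series with leading coefficient $1$. Level 3: $X_3=\frac{w}{(1+27w)^2}$ with $w=\eta_3^{12}/\eta_1^{12}$, and $Z_3=\eta_1^2\eta_3^2/X_3^{1/3}$. Level 6: $X_6=\frac{w}{(1-w)^2}$ with $w=\frac{\eta_1^{12}\eta_6^{12}}{\eta_2^{12}\eta_3^{12}}$, and $Z_6=\eta_1\eta_2\eta_3\eta_6/X_6^{1/2}$. For $\ell\in\{3,6\}$, $X_\ell=q+O(q^2)$, $Z_\ell=1+O(q)$, the coefficients $T_\ell(n)$ are defined by $Z_\ell=\sum_{n\ge0}T_\ell(n)X_\ell^n$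 near $q=0$, and $F_\ell(x)=\sum_{n\ge0}T_\ell(n)x^n$. One has $F_3(x)=\sum_{n\ge0}\binom{3n}{n}\binom{2n}{n}^2x^n$. Equivalently for level 6: $T_6(0)=1$ and, for $n\ge0$, $(n+1)^3T_6(n+1)=\sum_{j=1}^2(n+1-\tfrac j2)\{h_j-(n+1)(n+1-j)g_j\}T_6(n+1-j)$ (with $T_6(-1)=0$), where $1+g_1x+g_2x^2=(1+4x)(1-32x)$ and $h_1x+h_2x^2=8x(1+12x)$. -}

module Defs where

open import Data.Nat.Base as ℕ using (ℕ; zero; suc)
open import Data.Nat.Combinatorics using (_C_)
open import Data.Integer.Base using (+_)
open import Data.Rational.Base as ℚ using (ℚ; 0ℚ; 1ℚ; _/_)
open import Data.Rational.Properties using (+-0-commutativeMonoid)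
open import Data.Fin.Base using (toℕ)
open import Data.Product.Base using (∃-syntax; _×_)
open import Algebra.Properties.CommutativeMonoid.Sum +-0-commutativeMonoid using (sum)
open import Relation.Binary.PropositionalEquality.Core using (_≡_; _≢_)

infix  4 _≈_ _≈_modX^_
infixl 6 _+_ _-_
infixl 7 _*_
infixr 8 _^_
infixl 9 _∘_

-- Functions analytic at x = 0 are represented by their Taylor series; every
-- series here has rational coefficients.  Two such functions agree in a
-- neighbourhood of 0 exactly when their Taylor coefficients agree.
Series : Set
Series = ℕ → ℚ

_≈_ : Series → Series → Set
f ≈ h = ∀ n → f n ≡ h n

-- f = h + O(x^k).
_≈_modX^_ : Series → Series → ℕ → Set
f ≈ h modX^ k = ∀ n → n ℕ.< k → f n ≡ h n

con : ℚ → Series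
con q zero    = q
con q (suc _) = 0ℚ

ι : ℕ → ℚ
ι n = + n / 1

# : ℕ → Series
# n = con (ι n)

X : Series
X 1 = 1ℚ
X _ = 0ℚ

_+_ _-_ _*_ : Series → Series → Series
(f + h) n = f n ℚ.+ h n
(f - h) n = f n ℚ.- h n
(f * h) n = sum {suc n} λ i → f (toℕ i) ℚ.* h (n ℕ.∸ toℕ i)

_^_ : Series → ℕ → Series
f ^ zero  = # 1
f ^ suc k = f * f ^ k

-- Substitution f(h(x)), meaningful only when h has zero constant term:
-- then h^k = O(x^k), so no term with k > n contributes to the coefficient of x^n.
_∘_ : Series → Series → Series
(f ∘ h) n = sum {suc n} λ k → f (toℕ k) ℚ.* (h ^ toℕ k) n

-- Positive radius of convergence.
Convergent : Series → Set
Convergent f = ∃[ M ] ∃[ K ] ∀ n → ℚ.∣ f n ∣ ℚ.≤ ι (M ℕ.* K ℕ.^ n)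

-- p is the quotient f / h near 0.  The denominator may vanish at 0 as long as it
-- is not identically zero (the singularity is then removable); since power series
-- over ℚ form an integral domain, p is uniquely determined.
IsQuotient : Series → Series → Series → Set
IsQuotient f h p = Convergent p × (∃[ n ] h n ≢ 0ℚ) × (p * h ≈ f)

-- r is the branch of f^(1/k) that is positive at 0; for k ≥ 1 it is unique.
IsRoot : ℕ → Series → Series → Set
IsRoot k f r = Convergent r × (r ^ k ≈ f) × (0ℚ ℚ.< r 0)

-- T₃ and T₆ are the coefficients in Z = Σ T(n) Xⁿ for the level 3 and level 6
-- weight two form Z and modular function X, given here by the binomial formula
-- and by the three-term recurrence respectively.
T₃ : ℕ → ℚ
T₃ n = ι (((3 ℕ.* n) C n) ℕ.* ((2 ℕ.* n) C n) ℕ.^ 2)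

-- 1 + g₁x + g₂x² and h₁x + h₂x².
gs hs : Series
gs = (# 1 + # 4 * X) * (# 1 - # 32 * X)
hs = # 8 * X * (# 1 + # 12 * X)

-- (n + 1 - j/2) (h_j - (n + 1)(n + 1 - j) g_j)
weight : ℕ → ℕ → ℚ
weight n j =
  (ι (suc n) ℚ.- + j / 2) ℚ.*
  (hs j ℚ.- ι (suc n) ℚ.* (ι (suc n) ℚ.- ι j) ℚ.* gs j)

-- The solution of
--   (n + 1)³ T₆(n + 1) = weight n 1 · T₆(n) + weight n 2 · T₆(n - 1),
-- with T₆(0) = 1 and T₆(-1) = 0.
T₆ : ℕ → ℚ
T₆ zero          = 1ℚ
T₆ (suc zero)    = weight 0 1 ℚ.* T₆ 0
T₆ (suc (suc n)) =
  + 1 / (suc (suc n) ℕ.^ 3) ℚ.*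
  (weight (suc n) 1 ℚ.* T₆ (suc n) ℚ.+ weight (suc n) 2 ℚ.* T₆ n)

F₃ F₆ : Series
F₃ = T₃
F₆ = T₆

c d g a b : Series
c = # 1 - # 19 * X + # 16 * X ^ 2
d = # 1 - # 5 * X
g = # 1 - # 32 * X
a = con (+ 5 / 2) - # 8 * X
b = con (+ 3 / 2)

{-# OPTIONS --safe #-}

-- With θ = x d/dx, the recurrence for T₆ says that F₆ satisfies a third-order
-- linear equation L(F) = 0, where, with W = 1 + g₁x + g₂x² and h = h₁x + h₂x²,
--   L(F) = θ(2W θ²F + (θW)(θF)) - 2h θF - (θh)F.
-- It has the quadratic first integral
--   Q(F) = 2F (2W θ²F + (θW)(θF)) - 2W (θF)² - 2hF²,  θQ(F) = 2F L(F),
-- so that L(F) = 0 is equivalent to the second-order equation Q(F) = 0 when F is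
-- regular at 0 and F(0) ≠ 0; likewise for F₃.  Put σ = ±√g, κ = (1 - σ)/2 and
-- P = 1/(1 + κ).  Then κ(1 - κ) = 8x, y∓ = κ(1 - κ)²P³/8, (a - bσ)^(1/2) = 1 + κ,
-- and the derivation ∂ = σθ acts rationally on κ: ∂κ = κ(1 - κ).  In these
-- coordinates Q₆(P · (F₃ ∘ y)) = Q₃(F₃) ∘ y = 0 comes down to three identities
-- between rational functions of κ, and since the linear equation of level 6 has a
-- single power series solution up to scaling, P · (F₃ ∘ y) is a multiple of F₆.
module Submission where

open import Defs using (ι)
open import Algebra.Bundles using (CommutativeRing)
import Algebra.Solver.Ring
open import Algebra.Solver.Ring.AlmostCommutativeRing
  using (fromCommutativeRing; _-Raw-AlmostCommutative⟶_)
open import Data.Fin using () renaming (#_ to fin)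
open import Data.Integer.Base as ℤ using (+_)
open import Data.Maybe.Base using (Maybe; just; nothing)
open import Data.Nat.Base as ℕ using (ℕ; zero; suc; _!; z≤n; s≤s)
import Data.Nat.Properties as ℕ
open import Data.Rational.Base as ℚ using (ℚ; 0ℚ; 1ℚ; _/_; toℚᵘ)
import Data.Rational.Properties as ℚ
open import Data.Vec.Base using (Vec; []; _∷_; lookup)
open import Data.Vec.Relation.Binary.Pointwise.Inductive as Pointwise using (Pointwise; []; _∷_)
open import Level using (0ℓ)
import Relation.Binary.PropositionalEquality as ≡
open import Relation.Nullary.Decidable using (yes; no; True; toWitness)

-- Passing through Q rather than transforming L directly keeps the third derivative of the composite
-- out of the calculation: only first and second derivatives are transformed. The parameter κ comes
-- from the square root: the curve σ² = 1 - 32x is rational, κ is a coordinate on it, and σ ↦ -σ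
-- becomes κ ↦ 1 - κ. Hence y⁺ and y⁻ are one rational function at conjugate points, and a single
-- calculation serves both signs. The branches differ only in their constant terms: κ(0) is 0 or 1,
-- so P(0) is 1 or 1/2, which accounts for the factor 2 in the formula for y⁺. The factor 1 - 32x of
-- W is a square in these coordinates; it disappears when θ is replaced by σθ. No division is
-- performed in the ring: P is a variable tied to κ by one relation, and every rational identity
-- becomes a polynomial identity with an explicit cofactor of that relation. Convergence is a
-- separate strand: coefficient bounds for √g, 1/(1 + 4x), T₃ and T₆, propagated through sums and
-- products. The formulas themselves are equalities of formal power series.

module DifferentialAlgebra
  (R : CommutativeRing 0ℓ 0ℓ)
  (morphism : ℚ.+-*-rawRing -Raw-AlmostCommutative⟶ fromCommutativeRing R)
  where

  open CommutativeRing R hiding (zero)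
  open _-Raw-AlmostCommutative⟶_ morphism using (+-homo; 0-homo; 1-homo) renaming (⟦_⟧ to C)
  open import Relation.Binary.Reasoning.Setoid setoid

  coefficientEq? : ∀ p q → Maybe (C p ≈ C q)
  coefficientEq? p q with p ℚ.≟ q
  ... | yes ≡.refl = just refl
  ... | no _       = nothing

  open Algebra.Solver.Ring ℚ.+-*-rawRing (fromCommutativeRing R) morphism coefficientEq? public
    using (Polynomial; op; var; _:^_; :-_; [+]; [*]; ⟦_⟧; ⟦_⟧↓; prove; solve; _:=_; _:+_; _:*_; _:-_)
    renaming (con to const)
  open import Algebra.Properties.Semiring.Exp semiring using (_^_; ^-congˡ)

  -- Derivations, and mechanical differentiation of polynomial expressions

  record IsDerivation (D : Carrier → Carrier) : Set where
    field
      D-cong : ∀ {f h} → f ≈ h → D f ≈ D h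
      D-C    : ∀ q → D (C q) ≈ 0#
      D-+    : ∀ f h → D (f + h) ≈ D f + D h
      D-*    : ∀ f h → D (f * h) ≈ D f * h + f * D h

  substitute : ∀ {m n} → Vec (Polynomial n) m → Polynomial m → Polynomial n
  substitute σ (op o p q) = op o (substitute σ p) (substitute σ q)
  substitute σ (const q)    = const q
  substitute σ (var i)    = lookup σ i
  substitute σ (p :^ k)   = substitute σ p :^ k
  substitute σ (:- p)     = :- substitute σ p

  -- The derivative of a polynomial expression, given the derivatives of its
  -- variables; these may involve further variables, which σ makes room for.
  derivative : ∀ {m n} → (σ δ : Vec (Polynomial n) m) → Polynomial m → Polynomial n
  derivative σ δ (op [+] p q)   = derivative σ δ p :+ derivative σ δ q
  derivative σ δ (op [*] p q)   = derivative σ δ p :* substitute σ q :+ substitute σ p :* derivative σ δ q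
  derivative σ δ (const q)        = const 0ℚ
  derivative σ δ (var i)        = lookup δ i
  derivative σ δ (p :^ zero)    = const 0ℚ
  derivative σ δ (p :^ suc k)   =
    derivative σ δ p :* (substitute σ p :^ k) :+ substitute σ p :* derivative σ δ (p :^ k)
  derivative σ δ (:- p)         = :- derivative σ δ p

  module _ {D} (isDerivation : IsDerivation D) where
    open IsDerivation isDerivation

    D-neg : ∀ f → D (- f) ≈ - D f
    D-neg f = begin
      D (- f)                      ≈⟨ solve 2 (λ a b → a := (:- b) :+ (b :+ a)) refl (D (- f)) (D f) ⟩
      - D f + (D f + D (- f))      ≈⟨ +-congˡ (D-+ f (- f)) ⟨
      - D f + D (f + - f)          ≈⟨ +-congˡ (D-cong (trans (-‿inverseʳ f) (sym 0-homo))) ⟩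
      - D f + D (C 0ℚ)             ≈⟨ +-congˡ (D-C 0ℚ) ⟩
      - D f + 0#                   ≈⟨ +-identityʳ _ ⟩
      - D f                        ∎

    module _ {m n} (σ δ : Vec (Polynomial n) m) (ρ : Vec Carrier m) (ρ′ : Vec Carrier n)
      (σ-correct : Pointwise (λ f p → f ≈ ⟦ p ⟧ ρ′) ρ σ)
      (δ-correct : Pointwise (λ f p → D f ≈ ⟦ p ⟧ ρ′) ρ δ)
      where

      substitute-correct : ∀ p → ⟦ p ⟧ ρ ≈ ⟦ substitute σ p ⟧ ρ′
      substitute-correct (op [+] p q) = +-cong (substitute-correct p) (substitute-correct q)
      substitute-correct (op [*] p q) = *-cong (substitute-correct p) (substitute-correct q)
      substitute-correct (const q)      = refl
      substitute-correct (var i)      = Pointwise.lookup σ-correct i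
      substitute-correct (p :^ k)     = ^-congˡ k (substitute-correct p)
      substitute-correct (:- p)       = -‿cong (substitute-correct p)

      derivative-correct : ∀ p → D (⟦ p ⟧ ρ) ≈ ⟦ derivative σ δ p ⟧ ρ′
      derivative-correct (op [+] p q) = trans (D-+ _ _) (+-cong (derivative-correct p) (derivative-correct q))
      derivative-correct (op [*] p q) = trans (D-* _ _) (+-cong
        (*-cong (derivative-correct p) (substitute-correct q))
        (*-cong (substitute-correct p) (derivative-correct q)))
      derivative-correct (const q)      = trans (D-C q) (sym 0-homo)
      derivative-correct (var i)      = Pointwise.lookup δ-correct i
      derivative-correct (p :^ zero)  =
        trans (D-cong (sym 1-homo)) (trans (D-C 1ℚ) (sym 0-homo))
      derivative-correct (p :^ suc k) = trans (D-* _ _) (+-cong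
        (*-cong (derivative-correct p) (^-congˡ k (substitute-correct p)))
        (*-cong (substitute-correct p) (derivative-correct (p :^ k))))
      derivative-correct (:- p)       = trans (D-neg _) (-‿cong (derivative-correct p))

      -- The derivative is computed on syntax, so a differential identity reduces to equality of two
      -- polynomial normal forms; at each use that equality holds by reflexivity.
      differentiate : ∀ p q → ⟦ derivative σ δ p ⟧↓ ρ′ ≈ ⟦ q ⟧↓ ρ′ → D (⟦ p ⟧ ρ) ≈ ⟦ q ⟧ ρ′
      differentiate p q normal = trans (derivative-correct p) (prove ρ′ (derivative σ δ p) q normal)

  -- The third-order operator and its quadratic first integral

  -- Equal to 2 (√V D)² F, without the square root.
  laplace : (Carrier → Carrier) → Carrier → Carrier → Carrier
  laplace D V F = C (ι 2) * V * D (D F) + D V * D F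

  linear quadratic : (Carrier → Carrier) → (V h F : Carrier) → Carrier
  linear    D V h F = D (laplace D V F) - C (ι 2) * h * D F - D h * F
  quadratic D V h F =
    C (ι 2) * F * laplace D V F - C (ι 2) * V * D F ^ 2 - C (ι 2) * h * F ^ 2

  quadratic-cong : ∀ {D} → IsDerivation D → ∀ {V V′ h h′} F → V ≈ V′ → h ≈ h′ →
    quadratic D V h F ≈ quadratic D V′ h′ F
  quadratic-cong isDerivation F V≈V′ h≈h′ = +-cong
    (+-cong (*-congˡ (+-cong (*-congʳ (*-congˡ V≈V′)) (*-congʳ (D-cong V≈V′)))) (-‿cong (*-congʳ (*-congˡ V≈V′))))
    (-‿cong (*-congʳ (*-congˡ h≈h′)))
    where open IsDerivation isDerivation

  v : ∀ i {n} {i<n : True (i ℕ.<? n)} → Polynomial n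
  v i {i<n = i<n} = var (fin i {m<n = i<n})

  -- The derivative of `2 V (D F)²` is exactly `2 * D F * laplace D V F`, so these terms cancel;
  -- what remains is a multiple of `F`.
  quadratic-integral : ∀ {D} → IsDerivation D → ∀ V h F →
    D (quadratic D V h F) ≈ C (ι 2) * F * linear D V h F
  quadratic-integral {D} isDerivation V h F =
    differentiate isDerivation
      -- The last variable, `laplace`, has its defining expression as value but an opaque derivative
      -- `v 7`; so neither `D (D (D F))` nor `D (D V)` ever appears.
      (v 0 ∷ v 1 ∷ v 3 ∷ v 5 ∷ const (ι 2) :* v 3 :* v 2 :+ v 4 :* v 1 ∷ [])
      (v 1 ∷ v 2 ∷ v 4 ∷ v 6 ∷ v 7 ∷ [])
      (F ∷ D F ∷ V ∷ h ∷ laplace D V F ∷ [])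
      (F ∷ D F ∷ D (D F) ∷ V ∷ D V ∷ h ∷ D h ∷ D (laplace D V F) ∷ [])
      (refl ∷ refl ∷ refl ∷ refl ∷ refl ∷ [])
      (refl ∷ refl ∷ refl ∷ refl ∷ refl ∷ [])
      (const (ι 2) :* v 0 :* v 4 :- const (ι 2) :* v 2 :* v 1 :^ 2 :- const (ι 2) :* v 3 :* v 0 :^ 2)
      (const (ι 2) :* v 0 :* (v 7 :- const (ι 2) :* v 5 :* v 1 :- v 6 :* v 0))
      refl

  -- Change of derivation

  scaled : Carrier → (Carrier → Carrier) → Carrier → Carrier
  scaled s D f = s * D f

  module _ {D} (isDerivation : IsDerivation D) (s : Carrier) where
    open IsDerivation isDerivation

    scaled-isDerivation : IsDerivation (scaled s D)
    scaled-isDerivation = record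
      { D-cong = λ f≈h → *-congˡ (D-cong f≈h)
      ; D-C    = λ q → trans (*-congˡ (D-C q)) (zeroʳ s)
      ; D-+    = λ f h → trans (*-congˡ (D-+ f h)) (distribˡ s (D f) (D h))
      ; D-*    = λ f h → trans (*-congˡ (D-* f h))
          (solve 5 (λ s f f₁ h h₁ → s :* (f₁ :* h :+ f :* h₁) := s :* f₁ :* h :+ f :* (s :* h₁))
            refl s f (D f) h (D h))
      }

    -- Formally √(V s²) D = √V (s D): a square factor of the leading coefficient can be moved into
    -- the derivation.
    laplace-scaled : ∀ V F → laplace D (V * s ^ 2) F ≈ laplace (scaled s D) V F
    laplace-scaled V F = begin
      C (ι 2) * (V * s ^ 2) * D (D F) + D (V * s ^ 2) * D F
        ≈⟨ +-congˡ (*-congʳ (differentiate isDerivation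
             (v 0 ∷ v 2 ∷ []) (v 1 ∷ v 3 ∷ []) (V ∷ s ∷ []) (V ∷ D V ∷ s ∷ D s ∷ [])
             (refl ∷ refl ∷ []) (refl ∷ refl ∷ [])
             (v 0 :* v 1 :^ 2) (v 1 :* v 2 :^ 2 :+ const (ι 2) :* v 0 :* v 2 :* v 3) refl)) ⟩
      C (ι 2) * (V * s ^ 2) * D (D F) + (D V * s ^ 2 + C (ι 2) * V * s * D s) * D F
        ≈⟨ solve 6 (λ V V₁ s s₁ F₁ F₂ →
             const (ι 2) :* (V :* s :^ 2) :* F₂ :+ (V₁ :* s :^ 2 :+ const (ι 2) :* V :* s :* s₁) :* F₁
             := const (ι 2) :* V :* (s :* (s₁ :* F₁ :+ s :* F₂)) :+ s :* V₁ :* (s :* F₁))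
             refl V (D V) s (D s) (D F) (D (D F)) ⟩
      C (ι 2) * V * (s * (D s * D F + s * D (D F))) + s * D V * (s * D F)
        ≈⟨ +-congʳ (*-congˡ (*-congˡ (D-* s (D F)))) ⟨
      C (ι 2) * V * (s * D (s * D F)) + s * D V * (s * D F) ∎

    quadratic-scaled : ∀ V h F → quadratic D (V * s ^ 2) h F ≈ quadratic (scaled s D) V h F
    quadratic-scaled V h F = +-congʳ (+-cong (*-congˡ (laplace-scaled V F)) (-‿cong
      (solve 3 (λ V s F₁ → const (ι 2) :* (V :* s :^ 2) :* F₁ :^ 2 := const (ι 2) :* V :* (s :* F₁) :^ 2)
        refl V s (D F))))

  -- The change of variable as identities in κ and P

  module Transformation {∂} (isDerivation : IsDerivation ∂) (κ P : Carrier)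
    (∂κ : ∂ κ ≈ κ - κ ^ 2) (P-inverse : (C 1ℚ + κ) * P ≈ C 1ℚ) where
    open IsDerivation isDerivation

    -- With 8x = κ - κ², `V` is 1 + 4x and `h` is 8x(1 + 12x). The other factor 1 - 32x = (1 - 2κ)²
    -- of the level 6 leading coefficient is absent because `∂` absorbs it. `τ` is the logarithmic
    -- derivative of `y`.
    V h y τ : Carrier
    V = C 1ℚ + C (+ 1 / 2) * (κ - κ ^ 2)
    h = (κ - κ ^ 2) * (C 1ℚ + C (+ 3 / 2) * (κ - κ ^ 2))
    y = C (+ 1 / 8) * κ * (C 1ℚ - κ) ^ 2 * P ^ 3
    τ = (C 1ℚ - C (ι 5) * κ) * P

    private
      -- The cofactors q below are found by dividing by (1 + κ) P - 1 in ℚ[κ][P].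
      modulo : ∀ {f h} q → f ≈ h + q * ((C 1ℚ + κ) * P - C 1ℚ) → f ≈ h
      modulo {f} {h} q f≈ = begin
        f                                        ≈⟨ f≈ ⟩
        h + q * ((C 1ℚ + κ) * P - C 1ℚ)          ≈⟨ +-congˡ (*-congˡ (+-congʳ P-inverse)) ⟩
        h + q * (C 1ℚ - C 1ℚ)                    ≈⟨ solve 2 (λ h q → h :+ q :* (const 1ℚ :- const 1ℚ) := h) refl h q ⟩
        h                                        ∎

    -- Apply `∂` to `(1 + κ) P = 1` and multiply by `P` to solve for `∂ P`.
    ∂P : ∂ P ≈ - (P ^ 2 * (κ - κ ^ 2))
    ∂P = begin
      ∂ P
        ≈⟨ modulo (- ∂ P) (solve 3 (λ κ P P₁ → P₁ :=
             P :* ((κ :- κ :^ 2) :* P :+ (const 1ℚ :+ κ) :* P₁) :- P :^ 2 :* (κ :- κ :^ 2)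
             :+ (:- P₁) :* ((const 1ℚ :+ κ) :* P :- const 1ℚ)) refl κ P (∂ P)) ⟩
      P * ((κ - κ ^ 2) * P + (C 1ℚ + κ) * ∂ P) - P ^ 2 * (κ - κ ^ 2)
        ≈⟨ +-congʳ (*-congˡ (differentiate isDerivation
             (v 0 ∷ v 1 ∷ []) (v 0 :- v 0 :^ 2 ∷ v 2 ∷ []) (κ ∷ P ∷ []) (κ ∷ P ∷ ∂ P ∷ [])
             (refl ∷ refl ∷ []) (∂κ ∷ refl ∷ [])
             ((const 1ℚ :+ v 0) :* v 1) ((v 0 :- v 0 :^ 2) :* v 1 :+ (const 1ℚ :+ v 0) :* v 2) refl)) ⟨
      P * ∂ ((C 1ℚ + κ) * P) - P ^ 2 * (κ - κ ^ 2)
        ≈⟨ +-congʳ (*-congˡ (trans (D-cong P-inverse) (D-C 1ℚ))) ⟩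
      P * 0# - P ^ 2 * (κ - κ ^ 2)
        ≈⟨ trans (+-congʳ (zeroʳ P)) (+-identityˡ _) ⟩
      - (P ^ 2 * (κ - κ ^ 2)) ∎

    private
      -- Syntactic copies of the series above, with `κ` as variable 0 and `P` as variable 1. A
      -- subscript counts applications of `∂`; `ideal` vanishes by `P-inverse`.
      κ₁ P₁ P₂ V₁ V′ h′ y′ τ′ τ₁ ideal : Polynomial 2
      κ₁ = v 0 :- v 0 :^ 2
      P₁ = :- (v 1 :^ 2 :* κ₁)
      P₂ = const (ι 2) :* v 1 :^ 3 :* κ₁ :^ 2 :- v 1 :^ 2 :* (const 1ℚ :- const (ι 2) :* v 0) :* κ₁
      V′ = const 1ℚ :+ const (+ 1 / 2) :* (v 0 :- v 0 :^ 2)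
      V₁ = const (+ 1 / 2) :* (const 1ℚ :- const (ι 2) :* v 0) :* κ₁
      h′ = (v 0 :- v 0 :^ 2) :* (const 1ℚ :+ const (+ 3 / 2) :* (v 0 :- v 0 :^ 2))
      y′ = const (+ 1 / 8) :* v 0 :* (const 1ℚ :- v 0) :^ 2 :* v 1 :^ 3
      τ′ = (const 1ℚ :- const (ι 5) :* v 0) :* v 1
      τ₁ = (:- const (ι 5)) :* κ₁ :* v 1 :+ (const 1ℚ :- const (ι 5) :* v 0) :* P₁
      ideal = (const 1ℚ :+ v 0) :* v 1 :- const 1ℚ

      ρ : Vec Carrier 2
      ρ = κ ∷ P ∷ []

      ∂-correct : ∀ p q → ⟦ derivative (v 0 ∷ v 1 ∷ []) (κ₁ ∷ P₁ ∷ []) p ⟧↓ ρ ≈ ⟦ q ⟧↓ ρ →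
        ∂ (⟦ p ⟧ ρ) ≈ ⟦ q ⟧ ρ
      ∂-correct = differentiate isDerivation (v 0 ∷ v 1 ∷ []) (κ₁ ∷ P₁ ∷ []) ρ ρ
        (refl ∷ refl ∷ []) (∂κ ∷ ∂P ∷ [])

    -- Logarithmic derivatives add up: 1 - κ from κ, -2κ from (1 - κ)², and -3κ(1 - κ)P from P³;
    -- over the denominator 1 + κ the sum is 1 - 5κ.
    ∂y : ∂ y ≈ τ * y
    ∂y = modulo (⟦ q ⟧ ρ) (∂-correct y′ (τ′ :* y′ :+ q :* ideal) refl)
      where
      q : Polynomial 2
      q = const (+ 1 / 8) :* v 1 :^ 3 :*
        (:- v 0 :+ const (ι 5) :* v 0 :^ 2 :- const (ι 7) :* v 0 :^ 3 :+ const (ι 3) :* v 0 :^ 4)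

    -- The coefficients of ∂²G, ∂G and G on both sides of quadratic-transformed.
    coefficient₂ : P ^ 2 * V * τ ^ 2 ≈ C 1ℚ - C (ι 108) * y
    coefficient₂ = modulo (⟦ q ⟧ ρ)
      (prove ρ (v 1 :^ 2 :* V′ :* τ′ :^ 2) (const 1ℚ :- const (ι 108) :* y′ :+ q :* ideal) refl)
      where
      q : Polynomial 2
      q = const 1ℚ :+ (const 1ℚ :+ v 0) :* v 1 :+ (const 1ℚ :+ v 0) :^ 2 :* v 1 :^ 2 :+
        v 1 :^ 3 :* (const 1ℚ :- const (+ 21 / 2) :* v 0 :+ const (ι 30) :* v 0 :^ 2 :- const (+ 25 / 2) :* v 0 :^ 3)

    -- Applying `∂` to `coefficient₂` gives `τ` times this identity. It is checked directly because
    -- `τ` need not be cancellable in the ring.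
    coefficient₁ : C (ι 2) * V * P * τ * ⟦ P₁ ⟧ ρ + C (ι 2) * V * P ^ 2 * ⟦ τ₁ ⟧ ρ + P ^ 2 * ⟦ V₁ ⟧ ρ * τ
      ≈ - (C (ι 108) * y)
    coefficient₁ = modulo (⟦ q ⟧ ρ)
      (prove ρ
        (const (ι 2) :* V′ :* v 1 :* τ′ :* P₁ :+ const (ι 2) :* V′ :* v 1 :^ 2 :* τ₁ :+ v 1 :^ 2 :* V₁ :* τ′)
        (:- (const (ι 108) :* y′) :+ q :* ideal) refl)
      where
      q : Polynomial 2
      q = v 1 :^ 3 :* (const (ι 26) :* v 0 :^ 2 :- const (ι 4) :* v 0 :- const (ι 32) :* v 0 :^ 3
        :+ const (ι 10) :* v 0 :^ 4)

    -- The left side is `quadratic ∂ V h P`, the case G = 1 of the transformation; the right side is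
    -- the potential term -2 · 24y of level 3.
    coefficient₀ : C (ι 2) * P * (C (ι 2) * V * ⟦ P₂ ⟧ ρ + ⟦ V₁ ⟧ ρ * ⟦ P₁ ⟧ ρ)
      - C (ι 2) * V * ⟦ P₁ ⟧ ρ ^ 2 - C (ι 2) * h * P ^ 2 ≈ - (C (ι 48) * y)
    coefficient₀ = modulo (⟦ q ⟧ ρ)
      (prove ρ
        (const (ι 2) :* v 1 :* (const (ι 2) :* V′ :* P₂ :+ V₁ :* P₁) :- const (ι 2) :* V′ :* P₁ :^ 2
          :- const (ι 2) :* h′ :* v 1 :^ 2)
        (:- (const (ι 48) :* y′) :+ q :* ideal) refl)
      where
      q : Polynomial 2
      q = v 1 :^ 2 :* (const (ι 2) :* v 0 :+ v 0 :^ 2 :- const (ι 6) :* v 0 :^ 3 :+ const (ι 3) :* v 0 :^ 4)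
        :+ v 1 :^ 3 :* (const (ι 6) :* v 0 :^ 2 :- const (ι 15) :* v 0 :^ 3 :+ const (ι 12) :* v 0 :^ 4
          :- const (ι 3) :* v 0 :^ 5)

    -- The hypotheses are the chain rule for `G₀ = F ∘ y`, `G₁ = θ F ∘ y`, `G₂ = θ (θ F) ∘ y`. The
    -- right side is then the level 3 form Q₃(F), with W₃ = 1 - 108x and h₃ = 24x, composed with
    -- `y`.
    quadratic-transformed : ∀ {G₀ G₁ G₂} → ∂ G₀ ≈ τ * G₁ → ∂ G₁ ≈ τ * G₂ →
      quadratic ∂ V h (P * G₀) ≈
      C (ι 2) * G₀ * (C (ι 2) * (C 1ℚ - C (ι 108) * y) * G₂ + - (C (ι 108) * y) * G₁)
        - C (ι 2) * (C 1ℚ - C (ι 108) * y) * G₁ ^ 2 + - (C (ι 48) * y) * G₀ ^ 2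
    quadratic-transformed {G₀} {G₁} {G₂} ∂G₀ ∂G₁ = begin
      quadratic ∂ V h F
        ≈⟨ +-congʳ (+-cong
             (*-congˡ (+-cong (*-congˡ ∂∂F) (*-cong ∂V ∂F)))
             (-‿cong (*-congˡ (^-congˡ 2 ∂F)))) ⟩
      C (ι 2) * F * (C (ι 2) * V * F₂ + dV * F₁) - C (ι 2) * V * F₁ ^ 2 - C (ι 2) * h * F ^ 2
        -- All eleven quantities are independent variables here: the expression is only collected by
        -- monomials in the `G`s, and the relation between `κ` and `P` enters afterwards through the
        -- three coefficient identities.
        ≈⟨ prove (dV ∷ dP ∷ ddP ∷ dτ ∷ V ∷ h ∷ P ∷ τ ∷ G₀ ∷ G₁ ∷ G₂ ∷ [])
             (const (ι 2) :* f :* (const (ι 2) :* v 4 :* f₂ :+ v 0 :* f₁) :- const (ι 2) :* v 4 :* f₁ :^ 2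
               :- const (ι 2) :* v 5 :* f :^ 2)
             (const (ι 2) :* v 8 :* (const (ι 2) :* c₂ :* v 10 :+ c₁ :* v 9)
               :- const (ι 2) :* c₂ :* v 9 :^ 2 :+ c₀ :* v 8 :^ 2) refl ⟩
      _ ≈⟨ +-cong (+-cong (*-congˡ (+-cong (*-congʳ (*-congˡ coefficient₂)) (*-congʳ coefficient₁)))
             (-‿cong (*-congʳ (*-congˡ coefficient₂)))) (*-congʳ coefficient₀) ⟩
      _ ∎
      where
      F dP ddP dV dτ F₁ F₂ : Carrier
      F   = P * G₀
      dP  = ⟦ P₁ ⟧ ρ
      ddP = ⟦ P₂ ⟧ ρ
      dV  = ⟦ V₁ ⟧ ρ
      dτ  = ⟦ τ₁ ⟧ ρ
      F₁  = dP * G₀ + P * τ * G₁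
      F₂  = ddP * G₀ + (C (ι 2) * dP * τ + P * dτ) * G₁ + P * τ ^ 2 * G₂
      ∂V : ∂ V ≈ dV
      ∂V = ∂-correct V′ V₁ refl
      ∂F : ∂ F ≈ F₁
      ∂F = differentiate isDerivation
        (v 0 ∷ v 3 ∷ []) (v 1 ∷ v 2 :* v 4 ∷ []) (P ∷ G₀ ∷ []) (P ∷ dP ∷ τ ∷ G₀ ∷ G₁ ∷ [])
        (refl ∷ refl ∷ []) (∂P ∷ ∂G₀ ∷ [])
        (v 0 :* v 1) (v 1 :* v 3 :+ v 0 :* v 2 :* v 4) refl
      ∂∂F : ∂ (∂ F) ≈ F₂
      ∂∂F = trans (D-cong ∂F) (differentiate isDerivation
        (v 0 ∷ v 1 ∷ v 3 ∷ v 5 ∷ v 6 ∷ []) (v 1 ∷ v 2 ∷ v 4 ∷ v 3 :* v 6 ∷ v 3 :* v 7 ∷ [])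
        (P ∷ dP ∷ τ ∷ G₀ ∷ G₁ ∷ []) (P ∷ dP ∷ ddP ∷ τ ∷ dτ ∷ G₀ ∷ G₁ ∷ G₂ ∷ [])
        (refl ∷ refl ∷ refl ∷ refl ∷ refl ∷ [])
        (∂P ∷ ∂-correct P₁ P₂ refl ∷ ∂-correct τ′ τ₁ refl ∷ ∂G₀ ∷ ∂G₁ ∷ [])
        (v 1 :* v 3 :+ v 0 :* v 2 :* v 4)
        (v 2 :* v 5 :+ (const (ι 2) :* v 1 :* v 3 :+ v 0 :* v 4) :* v 6 :+ v 0 :* v 3 :^ 2 :* v 7) refl)
      f f₁ f₂ c₀ c₁ c₂ : Polynomial 11
      f  = v 6 :* v 8
      f₁ = v 1 :* v 8 :+ v 6 :* v 7 :* v 9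
      f₂ = v 2 :* v 8 :+ (const (ι 2) :* v 1 :* v 7 :+ v 6 :* v 3) :* v 9 :+ v 6 :* v 7 :^ 2 :* v 10
      c₂ = v 6 :^ 2 :* v 4 :* v 7 :^ 2
      c₁ = const (ι 2) :* v 4 :* v 6 :* v 7 :* v 1 :+ const (ι 2) :* v 4 :* v 6 :^ 2 :* v 3 :+ v 6 :^ 2 :* v 0 :* v 7
      c₀ = const (ι 2) :* v 6 :* (const (ι 2) :* v 4 :* v 2 :+ v 0 :* v 1) :- const (ι 2) :* v 4 :* v 1 :^ 2
        :- const (ι 2) :* v 5 :* v 6 :^ 2

open import Defs
open import Algebra.Properties.CommutativeMonoid.Sum ℚ.+-0-commutativeMonoid using (sum; sum-cong-≗)
open import Data.Fin.Base using (toℕ)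
import Data.Integer.Properties as ℤ
open import Data.Nat.Combinatorics using (_C_; nCk≡n!/k![n-k]!; k![n∸k]!∣n!)
open import Data.Nat.DivMod using (m/n*n≡m)
open import Data.Nat.Induction using (<-rec)
import Data.Nat.Solver as ℕ
open import Data.Product.Base using (∃-syntax; _×_; _,_)
import Data.Rational.Solver as ℚ
import Data.Rational.Unnormalised.Base as ℚᵘ
import Data.Rational.Unnormalised.Properties as ℚᵘ
open import Relation.Binary.PropositionalEquality
  using (_≡_; _≢_; refl; sym; trans; cong; cong₂; subst; module ≡-Reasoning)
open import Relation.Binary.Structures using (IsEquivalence)

module ℚSolver where
  open ℚ.+-*-Solver public using (solve; _:=_; _:+_; _:*_; _:-_; :-_) renaming (con to const)

-- The commutative ring of formal power series

tail : Series → Series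
tail f n = f (suc n)

neg : Series → Series
neg f n = ℚ.- f n

≈-isEquivalence : IsEquivalence _≈_
≈-isEquivalence = record
  { refl  = λ _ → refl
  ; sym   = λ f≈h n → sym (f≈h n)
  ; trans = λ f≈h h≈k n → trans (f≈h n) (h≈k n)
  }

*-cong : ∀ {f f′ h h′} → f ≈ f′ → h ≈ h′ → f * h ≈ f′ * h′
*-cong f≈f′ h≈h′ n =
  sum-cong-≗ {n = suc n} λ i → cong₂ ℚ._*_ (f≈f′ (toℕ i)) (h≈h′ (n ℕ.∸ toℕ i))

*-distribʳ : ∀ f h k → (h + k) * f ≈ h * f + k * f
*-distribʳ f h k zero = ℚSolver.solve 3 (λ f h k → let open ℚSolver in
  (h :+ k) :* f :+ const 0ℚ := (h :* f :+ const 0ℚ) :+ (k :* f :+ const 0ℚ)) refl (f 0) (h 0) (k 0)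
*-distribʳ f h k (suc n)
  rewrite *-distribʳ f (tail h) (tail k) n =
  ℚSolver.solve 5 (λ f h k a b → let open ℚSolver in
    (h :+ k) :* f :+ (a :+ b) := (h :* f :+ a) :+ (k :* f :+ b))
    refl (f (suc n)) (h 0) (k 0) ((tail h * f) n) ((tail k * f) n)

-- The convolution unfolds at its left end by computation; splitting off the right end is what makes
-- commutativity an induction.
*-sucʳ : ∀ f h n → (f * h) (suc n) ≡ (f * tail h) n ℚ.+ f (suc n) ℚ.* h 0
*-sucʳ f h zero = ℚSolver.solve 4 (λ f₀ f₁ h₀ h₁ → let open ℚSolver in
  f₀ :* h₁ :+ (f₁ :* h₀ :+ const 0ℚ) := (f₀ :* h₁ :+ const 0ℚ) :+ f₁ :* h₀)
  refl (f 0) (f 1) (h 0) (h 1)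
*-sucʳ f h (suc n) = trans
  (cong (f 0 ℚ.* h (suc (suc n)) ℚ.+_) (*-sucʳ (tail f) h n))
  (sym (ℚ.+-assoc (f 0 ℚ.* h (suc (suc n))) ((tail f * tail h) n) (f (suc (suc n)) ℚ.* h 0)))

*-comm : ∀ f h → f * h ≈ h * f
*-comm f h zero    = cong (ℚ._+ 0ℚ) (ℚ.*-comm (f 0) (h 0))
*-comm f h (suc n) = begin
  f 0 ℚ.* h (suc n) ℚ.+ (tail f * h) n  ≡⟨ cong₂ ℚ._+_ (ℚ.*-comm (f 0) _) (*-comm (tail f) h n) ⟩
  h (suc n) ℚ.* f 0 ℚ.+ (h * tail f) n  ≡⟨ ℚ.+-comm (h (suc n) ℚ.* f 0) _ ⟩
  (h * tail f) n ℚ.+ h (suc n) ℚ.* f 0  ≡⟨ *-sucʳ h f n ⟨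
  (h * f) (suc n)                       ∎
  where open ≡-Reasoning

scale : ℚ → Series → Series
scale q f n = q ℚ.* f n

scale-* : ∀ q f h → scale q f * h ≈ scale q (f * h)
scale-* q f h zero = ℚSolver.solve 3 (λ q f h → let open ℚSolver in
  (q :* f) :* h :+ const 0ℚ := q :* (f :* h :+ const 0ℚ)) refl q (f 0) (h 0)
scale-* q f h (suc n)
  rewrite scale-* q (tail f) h n =
  ℚSolver.solve 4 (λ q f h a → let open ℚSolver in (q :* f) :* h :+ q :* a := q :* (f :* h :+ a))
    refl q (f 0) (h (suc n)) ((tail f * h) n)

*-assoc : ∀ f h k → (f * h) * k ≈ f * (h * k)
*-assoc f h k zero = ℚSolver.solve 3 (λ f h k → let open ℚSolver in
  (f :* h :+ const 0ℚ) :* k :+ const 0ℚ := f :* (h :* k :+ const 0ℚ) :+ const 0ℚ)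
  refl (f 0) (h 0) (k 0)
*-assoc f h k (suc n) = begin
  (f 0 ℚ.* h 0 ℚ.+ 0ℚ) ℚ.* k (suc n) ℚ.+ (tail (f * h) * k) n
    ≡⟨ cong ((f 0 ℚ.* h 0 ℚ.+ 0ℚ) ℚ.* k (suc n) ℚ.+_) (begin
         -- By computation `tail (f * h)` is this sum, which is why scalar multiples are needed for
         -- associativity.
         ((scale (f 0) (tail h) + tail f * h) * k) n
           ≡⟨ *-distribʳ k (scale (f 0) (tail h)) (tail f * h) n ⟩
         (scale (f 0) (tail h) * k) n ℚ.+ ((tail f * h) * k) n
           ≡⟨ cong₂ ℚ._+_ (scale-* (f 0) (tail h) k n) (*-assoc (tail f) h k n) ⟩
         f 0 ℚ.* (tail h * k) n ℚ.+ (tail f * (h * k)) n ∎) ⟩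
  (f 0 ℚ.* h 0 ℚ.+ 0ℚ) ℚ.* k (suc n) ℚ.+ (f 0 ℚ.* (tail h * k) n ℚ.+ (tail f * (h * k)) n)
    ≡⟨ ℚSolver.solve 5 (λ f h k a b → let open ℚSolver in
         (f :* h :+ const 0ℚ) :* k :+ (f :* a :+ b) := f :* (h :* k :+ a) :+ b)
         refl (f 0) (h 0) (k (suc n)) ((tail h * k) n) ((tail f * (h * k)) n) ⟩
  f 0 ℚ.* (h 0 ℚ.* k (suc n) ℚ.+ (tail h * k) n) ℚ.+ (tail f * (h * k)) n ∎
  where open ≡-Reasoning

zero-* : ∀ f h → (∀ n → f n ≡ 0ℚ) → ∀ n → (f * h) n ≡ 0ℚ
zero-* f h f≈0 zero    rewrite f≈0 0 = trans (ℚ.+-identityʳ _) (ℚ.*-zeroˡ (h 0))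
zero-* f h f≈0 (suc n) rewrite f≈0 0 | zero-* (tail f) h (λ m → f≈0 (suc m)) n =
  trans (ℚ.+-identityʳ _) (ℚ.*-zeroˡ (h (suc n)))

con-* : ∀ q f → con q * f ≈ scale q f
con-* q f zero    = ℚ.+-identityʳ (q ℚ.* f 0)
con-* q f (suc n) rewrite zero-* (tail (con q)) f (λ _ → refl) n = ℚ.+-identityʳ (q ℚ.* f (suc n))

seriesRing : CommutativeRing 0ℓ 0ℓ
seriesRing = record
  { Carrier = Series ; _≈_ = _≈_ ; _+_ = _+_ ; _*_ = _*_ ; -_ = neg
  ; 0# = # 0 ; 1# = # 1
  ; isCommutativeRing = record
    { isRing = record
      { +-isAbelianGroup = record
        { isGroup = record
          { isMonoid = record
            { isSemigroup = record
              { isMagma = record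
                { isEquivalence = ≈-isEquivalence
                ; ∙-cong = λ f≈f′ h≈h′ n → cong₂ ℚ._+_ (f≈f′ n) (h≈h′ n)
                }
              ; assoc = λ f h k n → ℚ.+-assoc (f n) (h n) (k n)
              }
            ; identity = +-identityˡ , λ f n → trans (ℚ.+-comm (f n) _) (+-identityˡ f n)
            }
          ; inverse = +-inverseˡ , λ f n → trans (ℚ.+-comm (f n) _) (+-inverseˡ f n)
          ; ⁻¹-cong = λ f≈h n → cong ℚ.-_ (f≈h n)
          }
        ; comm = λ f h n → ℚ.+-comm (f n) (h n)
        }
      ; *-cong = *-cong
      ; *-assoc = *-assoc
      ; *-identity = *-identityˡ , λ f n → trans (*-comm f (# 1) n) (*-identityˡ f n)
      ; distrib = (λ f h k n → trans (*-comm f (h + k) n)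
                     (trans (*-distribʳ f h k n) (cong₂ ℚ._+_ (*-comm h f n) (*-comm k f n))))
                , *-distribʳ
      }
    ; *-comm = *-comm
    }
  }
  where
  +-identityˡ : ∀ f → # 0 + f ≈ f
  +-identityˡ f zero    = ℚ.+-identityˡ (f 0)
  +-identityˡ f (suc n) = ℚ.+-identityˡ (f (suc n))
  +-inverseˡ : ∀ f → neg f + f ≈ # 0
  +-inverseˡ f zero    = ℚ.+-inverseˡ (f 0)
  +-inverseˡ f (suc n) = ℚ.+-inverseˡ (f (suc n))
  *-identityˡ : ∀ f → # 1 * f ≈ f
  *-identityˡ f n = trans (con-* 1ℚ f n) (ℚ.*-identityˡ (f n))

open CommutativeRing seriesRing
  using (setoid; +-cong; +-congˡ; +-congʳ; +-identityˡ; +-identityʳ; *-congˡ; *-congʳ; *-identityʳ; -‿cong)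
  renaming (refl to ≈-refl; sym to ≈-sym; trans to ≈-trans; zeroʳ to *-zeroʳ; distribˡ to *-distribˡ)

con-+ : ∀ p q → con (p ℚ.+ q) ≈ con p + con q
con-+ p q zero    = refl
con-+ p q (suc n) = refl

con-*-con : ∀ p q → con (p ℚ.* q) ≈ con p * con q
con-*-con p q zero    = sym (con-* p (con q) 0)
con-*-con p q (suc n) = sym (trans (con-* p (con q) (suc n)) (ℚ.*-zeroʳ p))

con-morphism : ℚ.+-*-rawRing -Raw-AlmostCommutative⟶ fromCommutativeRing seriesRing
con-morphism = record
  { ⟦_⟧    = con
  ; +-homo = con-+
  ; *-homo = con-*-con
  ; -‿homo = λ p → λ { zero → refl ; (suc n) → refl }
  ; 0-homo = λ _ → refl
  ; 1-homo = λ _ → refl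
  }

module SeriesSolver = DifferentialAlgebra seriesRing con-morphism
open SeriesSolver hiding (solve; const; _:=_; _:+_; _:*_; _:-_; :-_; _:^_)

-- Arithmetic of the embedding of ℕ in ℚ

ι-fraction : ∀ n → toℚᵘ (ι n) ℚᵘ.≃ ℚᵘ.mkℚᵘ (+ n) 0
ι-fraction n = ℚ.toℚᵘ-fromℚᵘ (ℚᵘ.mkℚᵘ (+ n) 0)

ι-+ : ∀ m n → ι (m ℕ.+ n) ≡ ι m ℚ.+ ι n
ι-+ m n = ℚ.toℚᵘ-injective (begin
  toℚᵘ (ι (m ℕ.+ n))                          ≈⟨ ι-fraction (m ℕ.+ n) ⟩
  ℚᵘ.mkℚᵘ (+ (m ℕ.+ n)) 0                     ≈⟨ ℚᵘ.*≡* (cong (ℤ._* + 1)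
                                                   (cong₂ ℤ._+_ (sym (ℤ.*-identityʳ (+ m))) (sym (ℤ.*-identityʳ (+ n))))) ⟩
  ℚᵘ.mkℚᵘ (+ m) 0 ℚᵘ.+ ℚᵘ.mkℚᵘ (+ n) 0        ≈⟨ ℚᵘ.+-cong (ι-fraction m) (ι-fraction n) ⟨
  toℚᵘ (ι m) ℚᵘ.+ toℚᵘ (ι n)                  ≈⟨ ℚ.toℚᵘ-homo-+ (ι m) (ι n) ⟨
  toℚᵘ (ι m ℚ.+ ι n)                          ∎)
  where open ℚᵘ.≃-Reasoning

ι-* : ∀ m n → ι (m ℕ.* n) ≡ ι m ℚ.* ι n
ι-* m n = ℚ.toℚᵘ-injective (begin
  toℚᵘ (ι (m ℕ.* n))                          ≈⟨ ι-fraction (m ℕ.* n) ⟩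
  ℚᵘ.mkℚᵘ (+ (m ℕ.* n)) 0                     ≈⟨ ℚᵘ.*≡* (cong (ℤ._* + 1) (ℤ.pos-* m n)) ⟩
  ℚᵘ.mkℚᵘ (+ m) 0 ℚᵘ.* ℚᵘ.mkℚᵘ (+ n) 0        ≈⟨ ℚᵘ.*-cong (ι-fraction m) (ι-fraction n) ⟨
  toℚᵘ (ι m) ℚᵘ.* toℚᵘ (ι n)                  ≈⟨ ℚ.toℚᵘ-homo-* (ι m) (ι n) ⟨
  toℚᵘ (ι m ℚ.* ι n)                          ∎)
  where open ℚᵘ.≃-Reasoning

ι-suc : ∀ n → ι (suc n) ≡ 1ℚ ℚ.+ ι n
ι-suc = ι-+ 1

ι-reciprocal : ∀ n .{{_ : ℕ.NonZero n}} → ι n ℚ.* (+ 1 / n) ≡ 1ℚ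
ι-reciprocal (suc n) = ℚ.toℚᵘ-injective (begin
  toℚᵘ (ι (suc n) ℚ.* (+ 1 / suc n))          ≈⟨ ℚ.toℚᵘ-homo-* (ι (suc n)) (+ 1 / suc n) ⟩
  toℚᵘ (ι (suc n)) ℚᵘ.* toℚᵘ (+ 1 / suc n)    ≈⟨ ℚᵘ.*-cong (ι-fraction (suc n)) (ℚ.toℚᵘ-fromℚᵘ (ℚᵘ.mkℚᵘ (+ 1) n)) ⟩
  ℚᵘ.mkℚᵘ (+ suc n) 0 ℚᵘ.* ℚᵘ.mkℚᵘ (+ 1) n    ≈⟨ ℚᵘ.*≡* (trans (ℤ.*-identityʳ _) (trans (ℤ.*-identityʳ (+ suc n))
                                                   (cong +_ (sym (trans (ℕ.*-identityˡ _) (ℕ.*-identityˡ (suc n))))))) ⟩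
  toℚᵘ 1ℚ                                     ∎)
  where open ℚᵘ.≃-Reasoning

-- Multiplication by x, locality of products, cancellation

tail-X : tail X ≈ con 1ℚ
tail-X zero    = refl
tail-X (suc n) = refl

X-*-zero : ∀ f → (X * f) 0 ≡ 0ℚ
X-*-zero f = trans (ℚ.+-identityʳ _) (ℚ.*-zeroˡ (f 0))

X-*-suc : ∀ f n → (X * f) (suc n) ≡ f n
X-*-suc f n = begin
  0ℚ ℚ.* f (suc n) ℚ.+ (tail X * f) n  ≡⟨ cong₂ ℚ._+_ (ℚ.*-zeroˡ (f (suc n)))
                                            (*-cong {h = f} tail-X (λ _ → refl) n) ⟩
  0ℚ ℚ.+ (con 1ℚ * f) n                ≡⟨ ℚ.+-identityˡ _ ⟩
  (con 1ℚ * f) n                       ≡⟨ trans (con-* 1ℚ f n) (ℚ.*-identityˡ (f n)) ⟩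
  f n                                  ∎
  where
  open ≡-Reasoning

*-agree : ∀ f {h k} n → (∀ m → m ℕ.≤ n → h m ≡ k m) → (f * h) n ≡ (f * k) n
*-agree f n h≡k = sum-cong-≗ {n = suc n} λ i → cong (f (toℕ i) ℚ.*_) (h≡k (n ℕ.∸ toℕ i) (ℕ.m∸n≤m n (toℕ i)))

head-*-suc : ∀ f h n → f 0 ≡ 0ℚ → (f * h) (suc n) ≡ (tail f * h) n
head-*-suc f h n f₀≡0 = trans
  (cong (λ q → q ℚ.* h (suc n) ℚ.+ (tail f * h) n) f₀≡0)
  (trans (cong (ℚ._+ (tail f * h) n) (ℚ.*-zeroˡ (h (suc n)))) (ℚ.+-identityˡ _))

*-zero-head : ∀ f h → f 0 ≡ 0ℚ → (f * h) 0 ≡ 0ℚ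
*-zero-head f h f₀≡0 =
  trans (cong (λ q → q ℚ.* h 0 ℚ.+ 0ℚ) f₀≡0) (trans (ℚ.+-identityʳ _) (ℚ.*-zeroˡ (h 0)))

-- A factor without constant term delays the other by one place, so coefficient n of the product
-- sees only coefficients below n. This drives every induction about composition.
*-agree-below : ∀ f {h k} n → f 0 ≡ 0ℚ → (∀ m → m ℕ.< n → h m ≡ k m) → (f * h) n ≡ (f * k) n
*-agree-below f {h} {k} zero    f₀≡0 h≡k = trans (*-zero-head f h f₀≡0) (sym (*-zero-head f k f₀≡0))
*-agree-below f {h} {k} (suc n) f₀≡0 h≡k = begin
  (f * h) (suc n)   ≡⟨ head-*-suc f h n f₀≡0 ⟩
  (tail f * h) n    ≡⟨ *-agree (tail f) n (λ m m≤n → h≡k m (s≤s m≤n)) ⟩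
  (tail f * k) n    ≡⟨ head-*-suc f k n f₀≡0 ⟨
  (f * k) (suc n)   ∎
  where open ≡-Reasoning

#0≡0 : ∀ n → # 0 n ≡ 0ℚ
#0≡0 zero    = refl
#0≡0 (suc n) = refl

-- Once `h` vanishes below n, coefficient n of the product is `f 0 * h n`. This is what later
-- removes the factor 2F from 2F L(F) = 0.
*-cancelˡ-zero : ∀ f {h} → f 0 ≢ 0ℚ → f * h ≈ # 0 → h ≈ # 0
*-cancelˡ-zero f {h} f₀≢0 fh≈0 = <-rec (λ n → h n ≡ # 0 n) step
  where
  open ≡-Reasoning
  instance
    f₀-nonZero : ℚ.NonZero (f 0)
    f₀-nonZero = ℚ.≢-nonZero f₀≢0
  leading : ∀ n → (∀ {m} → m ℕ.< n → h m ≡ # 0 m) → f 0 ℚ.* h n ≡ (f * h) n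
  leading zero    h≡0 = sym (ℚ.+-identityʳ _)
  leading (suc n) h≡0 = sym (begin
    f 0 ℚ.* h (suc n) ℚ.+ (tail f * h) n       ≡⟨ cong (f 0 ℚ.* h (suc n) ℚ.+_) (begin
      (tail f * h) n      ≡⟨ *-agree (tail f) n (λ m m≤n → h≡0 (s≤s m≤n)) ⟩
      (tail f * # 0) n    ≡⟨ *-zeroʳ (tail f) n ⟩
      # 0 n               ≡⟨ #0≡0 n ⟩
      0ℚ                  ∎) ⟩
    f 0 ℚ.* h (suc n) ℚ.+ 0ℚ                   ≡⟨ ℚ.+-identityʳ _ ⟩
    f 0 ℚ.* h (suc n)                          ∎)
  step : ∀ n → (∀ {m} → m ℕ.< n → h m ≡ # 0 m) → h n ≡ # 0 n
  step n h≡0 = begin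
    h n                             ≡⟨ ℚ.*-identityˡ (h n) ⟨
    1ℚ ℚ.* h n                      ≡⟨ cong (ℚ._* h n) (ℚ.*-inverseˡ (f 0)) ⟨
    ℚ.1/ (f 0) ℚ.* f 0 ℚ.* h n      ≡⟨ ℚ.*-assoc (ℚ.1/ (f 0)) (f 0) (h n) ⟩
    ℚ.1/ (f 0) ℚ.* (f 0 ℚ.* h n)    ≡⟨ cong (ℚ.1/ (f 0) ℚ.*_) (trans (leading n h≡0) (fh≈0 n)) ⟩
    ℚ.1/ (f 0) ℚ.* # 0 n            ≡⟨ con-* (ℚ.1/ (f 0)) (# 0) n ⟨
    (con (ℚ.1/ (f 0)) * # 0) n      ≡⟨ *-zeroʳ (con (ℚ.1/ (f 0))) n ⟩
    # 0 n                           ∎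

-- The derivation x d/dx

θ : Series → Series
θ f n = ι n ℚ.* f n

tail-θ : ∀ f → tail (θ f) ≈ θ (tail f) + tail f
tail-θ f n = trans (cong (ℚ._* f (suc n)) (ι-suc n))
  (ℚSolver.solve 2 (λ m a → let open ℚSolver in (const 1ℚ :+ m) :* a := m :* a :+ a)
    refl (ι n) (f (suc n)))

θ-* : ∀ f h → θ (f * h) ≈ θ f * h + f * θ h
θ-* f h zero = ℚSolver.solve 2 (λ f h →
  let open ℚSolver in const 0ℚ :* (f :* h :+ const 0ℚ) := (const 0ℚ :* f :* h :+ const 0ℚ) :+ (f :* (const 0ℚ :* h) :+ const 0ℚ))
  refl (f 0) (h 0)
θ-* f h (suc n) = begin
  ι (suc n) ℚ.* (f 0 ℚ.* h (suc n) ℚ.+ (tail f * h) n)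
    ≡⟨ cong (ℚ._* (f 0 ℚ.* h (suc n) ℚ.+ (tail f * h) n)) (ι-suc n) ⟩
  (1ℚ ℚ.+ ι n) ℚ.* (f 0 ℚ.* h (suc n) ℚ.+ (tail f * h) n)
    ≡⟨ ℚSolver.solve 4 (λ m f h a → let open ℚSolver in
         (const 1ℚ :+ m) :* (f :* h :+ a) := f :* ((const 1ℚ :+ m) :* h) :+ (a :+ m :* a))
         refl (ι n) (f 0) (h (suc n)) ((tail f * h) n) ⟩
  f 0 ℚ.* ((1ℚ ℚ.+ ι n) ℚ.* h (suc n)) ℚ.+ ((tail f * h) n ℚ.+ θ (tail f * h) n)
    ≡⟨ cong₂ ℚ._+_ (cong (λ m → f 0 ℚ.* (m ℚ.* h (suc n))) (sym (ι-suc n)))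
         (cong ((tail f * h) n ℚ.+_) (θ-* (tail f) h n)) ⟩
  f 0 ℚ.* θ h (suc n) ℚ.+ ((tail f * h) n ℚ.+ ((θ (tail f) * h) n ℚ.+ (tail f * θ h) n))
    ≡⟨ ℚSolver.solve 6 (λ a b c d f h → let open ℚSolver in
         a :+ (b :+ (c :+ d)) := const 0ℚ :* f :* h :+ (c :+ b) :+ (a :+ d))
         refl (f 0 ℚ.* θ h (suc n)) ((tail f * h) n) ((θ (tail f) * h) n) ((tail f * θ h) n) (f 0) (h (suc n)) ⟩
  0ℚ ℚ.* f 0 ℚ.* h (suc n) ℚ.+ ((θ (tail f) * h) n ℚ.+ (tail f * h) n)
    ℚ.+ (f 0 ℚ.* θ h (suc n) ℚ.+ (tail f * θ h) n)
    ≡⟨ cong (λ q → 0ℚ ℚ.* f 0 ℚ.* h (suc n) ℚ.+ q ℚ.+ (f 0 ℚ.* θ h (suc n) ℚ.+ (tail f * θ h) n))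
         (trans (sym (*-distribʳ h (θ (tail f)) (tail f) n)) (sym (*-cong {h = h} (tail-θ f) (λ _ → refl) n))) ⟩
  0ℚ ℚ.* f 0 ℚ.* h (suc n) ℚ.+ (tail (θ f) * h) n
    ℚ.+ (f 0 ℚ.* θ h (suc n) ℚ.+ (tail f * θ h) n) ∎
  where open ≡-Reasoning

θ-isDerivation : IsDerivation θ
θ-isDerivation = record
  { D-cong = λ f≈h n → cong (ι n ℚ.*_) (f≈h n)
  ; D-C    = λ q → λ { zero → ℚ.*-zeroˡ q ; (suc n) → ℚ.*-zeroʳ (ι (suc n)) }
  ; D-+    = λ f h n → ℚ.*-distribˡ-+ (ι n) (f n) (h n)
  ; D-*    = θ-*
  }

θX : θ X ≈ X
θX zero          = refl
θX (suc zero)    = refl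
θX (suc (suc n)) = ℚ.*-zeroʳ (ι (suc (suc n)))

-- Composition of power series

combination : ℕ → Series → (ℕ → Series) → Series
combination N F e n = sum {N} λ k → F (toℕ k) ℚ.* e (toℕ k) n

*-combination : ∀ f N F e → f * combination N F e ≈ combination N F (λ k → f * e k)
*-combination f zero    F e n = trans (*-comm f (combination 0 F e) n)
  (zero-* (combination 0 F e) f (λ _ → refl) n)
*-combination f (suc N) F e n = begin
  (f * (scale (F 0) (e 0) + combination N (tail F) (λ k → e (suc k)))) n
    ≡⟨ *-distribˡ f (scale (F 0) (e 0)) (combination N (tail F) (λ k → e (suc k))) n ⟩
  (f * scale (F 0) (e 0)) n ℚ.+ (f * combination N (tail F) (λ k → e (suc k))) n
    ≡⟨ cong₂ ℚ._+_ (begin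
         (f * scale (F 0) (e 0)) n         ≡⟨ *-comm f (scale (F 0) (e 0)) n ⟩
         (scale (F 0) (e 0) * f) n         ≡⟨ scale-* (F 0) (e 0) f n ⟩
         F 0 ℚ.* (e 0 * f) n               ≡⟨ cong (F 0 ℚ.*_) (*-comm (e 0) f n) ⟩
         F 0 ℚ.* (f * e 0) n               ∎)
       (*-combination f N (tail F) (λ k → e (suc k)) n) ⟩
  combination (suc N) F (λ k → f * e k) n ∎
  where open ≡-Reasoning

private
  partial : ℕ → Series → Series → Series
  partial N F y = combination N F (y ^_)

  partial-suc : ∀ N F y → partial (suc N) F y ≈ con (F 0) + y * partial N (tail F) y
  partial-suc N F y n = cong₂ ℚ._+_
    (trans (sym (con-* (F 0) (# 1) n)) (*-identityʳ (con (F 0)) n))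
    (sym (*-combination y N (tail F) (y ^_) n))

module Composition (y : Series) (y₀≡0 : y 0 ≡ 0ℚ) where

  private
    -- The definition of `∘` truncates at a depth depending on the coefficient. Any depth beyond n
    -- gives the same coefficient n, because each further term carries one more factor `y` with zero
    -- constant term.
    partial-stable : ∀ n M N F → n ℕ.< M → n ℕ.< N → partial M F y n ≡ partial N F y n
    partial-stable = <-rec _ step
      where
      open ≡-Reasoning
      step : ∀ n → (∀ {m} → m ℕ.< n → ∀ M N F → m ℕ.< M → m ℕ.< N → partial M F y m ≡ partial N F y m) →
        ∀ M N F → n ℕ.< M → n ℕ.< N → partial M F y n ≡ partial N F y n
      step n ih (suc M) (suc N) F n<M n<N = begin
        partial (suc M) F y n                    ≡⟨ partial-suc M F y n ⟩
        (con (F 0) + y * partial M (tail F) y) n ≡⟨ cong (con (F 0) n ℚ.+_)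
          (*-agree-below y n y₀≡0 λ m m<n → ih m<n M N (tail F)
            (ℕ.<-≤-trans m<n (ℕ.s≤s⁻¹ n<M)) (ℕ.<-≤-trans m<n (ℕ.s≤s⁻¹ n<N))) ⟩
        (con (F 0) + y * partial N (tail F) y) n ≡⟨ partial-suc N F y n ⟨
        partial (suc N) F y n                    ∎

  -- This is F = F(0) + x · tail F evaluated at `y`. Together with uniqueness of its solution it
  -- replaces all manipulation of the truncated sums.
  ∘-unfold : ∀ F → F ∘ y ≈ con (F 0) + y * (tail F ∘ y)
  ∘-unfold F n = trans (partial-suc n F y n) (cong (con (F 0) n ℚ.+_)
    (*-agree-below y n y₀≡0 λ m m<n → partial-stable m n (suc m) (tail F) m<n (ℕ.n<1+n m)))

  ∘-cong : ∀ {F H} → F ≈ H → F ∘ y ≈ H ∘ y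
  ∘-cong F≈H n = sum-cong-≗ {n = suc n} λ k → cong (ℚ._* (y ^ toℕ k) n) (F≈H (toℕ k))

  -- Since y(0) = 0, the map f ↦ e + y f is a contraction in the x-adic metric.
  fixed-point-unique : ∀ {I : Set} (next : I → I) (e f h : I → Series) →
    (∀ i → f i ≈ e i + y * f (next i)) → (∀ i → h i ≈ e i + y * h (next i)) → ∀ i → f i ≈ h i
  fixed-point-unique next e f h f-fixed h-fixed i n = <-rec (λ n → ∀ i → f i n ≡ h i n) step n i
    where
    step : ∀ n → (∀ {m} → m ℕ.< n → ∀ i → f i m ≡ h i m) → ∀ i → f i n ≡ h i n
    step n ih i = trans (f-fixed i n) (trans
      (cong (e i n ℚ.+_) (*-agree-below y n y₀≡0 λ m m<n → ih m<n (next i)))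
      (sym (h-fixed i n)))

  ∘-con : ∀ q → con q ∘ y ≈ con q
  ∘-con q = ≈-trans (∘-unfold (con q)) (≈-trans
    (+-congˡ {con q} (≈-trans (*-congˡ {y} tail∘) (*-zeroʳ y)))
    (+-identityʳ (con q)))
    where
    tail∘ : tail (con q) ∘ y ≈ # 0
    -- `tail (con q)` is its own tail by computation, so the family is constant and its index a
    -- dummy.
    tail∘ = fixed-point-unique {I = Series} (λ f → f) (λ _ → # 0) (λ _ → tail (con q) ∘ y) (λ _ → # 0)
      (λ _ → ∘-unfold (tail (con q)))
      (λ _ → ≈-sym {# 0 + y * # 0} {# 0} (≈-trans (+-congˡ {# 0} (*-zeroʳ y)) (+-identityʳ (# 0))))
      (# 0)

  ∘-X : X ∘ y ≈ y
  ∘-X = ≈-trans (∘-unfold X) (≈-trans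
    (+-congˡ {# 0} (≈-trans (*-congˡ {y} (≈-trans (∘-cong tail-X) (∘-con 1ℚ))) (*-identityʳ y)))
    (+-identityˡ y))

  ∘-+ : ∀ F H → (F + H) ∘ y ≈ F ∘ y + H ∘ y
  ∘-+ F H = fixed-point-unique (λ (F , H) → tail F , tail H) (λ (F , H) → con (F 0 ℚ.+ H 0))
    (λ (F , H) → (F + H) ∘ y) (λ (F , H) → F ∘ y + H ∘ y)
    (λ (F , H) → ∘-unfold (F + H))
    (λ (F , H) → ≈-trans (+-cong (∘-unfold F) (∘-unfold H)) (≈-trans
      (solve 5 (λ a b y f h → (a :+ y :* f) :+ (b :+ y :* h) := (a :+ b) :+ y :* (f :+ h)) ≈-refl
        (con (F 0)) (con (H 0)) y (tail F ∘ y) (tail H ∘ y))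
      (+-congʳ {y * (tail F ∘ y + tail H ∘ y)} (≈-sym {con (F 0 ℚ.+ H 0)} (con-+ (F 0) (H 0))))))
    (F , H)
    where open SeriesSolver using (solve; _:+_; _:*_; _:=_)

  scale-∘ : ∀ q F → scale q F ∘ y ≈ con q * (F ∘ y)
  scale-∘ q = fixed-point-unique tail (λ F → con (q ℚ.* F 0)) (λ F → scale q F ∘ y) (λ F → con q * (F ∘ y))
    (λ F → ∘-unfold (scale q F))
    (λ F → ≈-trans (*-congˡ {con q} (∘-unfold F)) (≈-trans
      (solve 4 (λ q a y f → q :* (a :+ y :* f) := q :* a :+ y :* (q :* f)) ≈-refl
        (con q) (con (F 0)) y (tail F ∘ y))
      (+-congʳ {y * (con q * (tail F ∘ y))} (≈-sym {con (q ℚ.* F 0)} (con-*-con q (F 0))))))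
    where open SeriesSolver using (solve; _:+_; _:*_; _:=_)

  -- Only `F` moves along its tails while `H` stays fixed: tail (F H) = F(0) · tail H + tail F · H,
  -- and the terms with F(0) reassemble to F(0) · (H ∘ y).
  ∘-* : ∀ F H → (F * H) ∘ y ≈ (F ∘ y) * (H ∘ y)
  ∘-* F H = fixed-point-unique tail (λ F → con (F 0) * (H ∘ y))
    (λ F → (F * H) ∘ y) (λ F → (F ∘ y) * (H ∘ y))
    (λ F → ≈-trans (∘-unfold (F * H)) (≈-trans
      (+-cong (con-head F) (*-congˡ {y} (≈-trans (∘-+ (scale (F 0) (tail H)) (tail F * H))
        (+-congʳ {(tail F * H) ∘ y} (scale-∘ (F 0) (tail H))))))
      (≈-trans
        (solve 5 (λ a b y h f → a :* b :+ y :* (a :* h :+ f) := a :* (b :+ y :* h) :+ y :* f) ≈-refl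
          (con (F 0)) (con (H 0)) y (tail H ∘ y) ((tail F * H) ∘ y))
        (+-congʳ {y * ((tail F * H) ∘ y)} (*-congˡ {con (F 0)} (≈-sym {H ∘ y} (∘-unfold H)))))))
    (λ F → ≈-trans (*-congʳ {H ∘ y} (∘-unfold F))
      (solve 4 (λ a y f h → (a :+ y :* f) :* h := a :* h :+ y :* (f :* h)) ≈-refl
        (con (F 0)) y (tail F ∘ y) (H ∘ y)))
    F
    where
    open SeriesSolver using (solve; _:+_; _:*_; _:=_)
    con-head : ∀ F → con ((F * H) 0) ≈ con (F 0) * con (H 0)
    con-head F = ≈-trans {con ((F * H) 0)} (λ n → cong (λ q → con q n) (ℚ.+-identityʳ (F 0 ℚ.* H 0)))
      (con-*-con (F 0) (H 0))

  neg-∘ : ∀ F → neg F ∘ y ≈ neg (F ∘ y)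
  neg-∘ F = ≈-trans (∘-cong (neg-scale F)) (≈-trans (scale-∘ (ℚ.- 1ℚ) F)
    (≈-trans (con-* (ℚ.- 1ℚ) (F ∘ y)) (≈-sym {neg (F ∘ y)} (neg-scale (F ∘ y)))))
    where
    neg-scale : ∀ f → neg f ≈ scale (ℚ.- 1ℚ) f
    neg-scale f n = trans (cong ℚ.-_ (sym (ℚ.*-identityˡ (f n)))) (ℚ.neg-distribˡ-* 1ℚ (f n))

  module _ {n} {ρ ρ′ : Vec Series n} (ρ∘y≈ρ′ : Pointwise (λ f h → f ∘ y ≈ h) ρ ρ′) where
    open SeriesSolver using (const; _:^_; :-_)

    ∘-polynomial : ∀ p → ⟦ p ⟧ ρ ∘ y ≈ ⟦ p ⟧ ρ′
    ∘-polynomial (op [+] p q)  = ≈-trans (∘-+ (⟦ p ⟧ ρ) (⟦ q ⟧ ρ)) (+-cong (∘-polynomial p) (∘-polynomial q))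
    ∘-polynomial (op [*] p q)  = ≈-trans (∘-* (⟦ p ⟧ ρ) (⟦ q ⟧ ρ)) (*-cong (∘-polynomial p) (∘-polynomial q))
    ∘-polynomial (const q)     = ∘-con q
    ∘-polynomial (var i)       = Pointwise.lookup ρ∘y≈ρ′ i
    ∘-polynomial (p :^ zero)   = ∘-con 1ℚ
    ∘-polynomial (p :^ suc k)  =
      ≈-trans (∘-* (⟦ p ⟧ ρ) (⟦ p :^ k ⟧ ρ)) (*-cong (∘-polynomial p) (∘-polynomial (p :^ k)))
    ∘-polynomial (:- p)        = ≈-trans (neg-∘ (⟦ p ⟧ ρ)) (-‿cong (∘-polynomial p))

  -- The chain rule: both sides solve f(F) = y τ (tail F ∘ y) + y f(tail F), on the left by the
  -- product rule and on the right by `tail-θ`.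
  scaled-θ-∘ : ∀ s τ → scaled s θ y ≈ τ * y → ∀ F → scaled s θ (F ∘ y) ≈ τ * (θ F ∘ y)
  scaled-θ-∘ s τ ∂y = fixed-point-unique tail (λ F → y * (τ * (tail F ∘ y)))
    (λ F → scaled s θ (F ∘ y)) (λ F → τ * (θ F ∘ y))
    (λ F → ≈-trans (D-cong (∘-unfold F)) (≈-trans (D-+ (con (F 0)) (y * (tail F ∘ y)))
      (≈-trans (+-cong (D-C (F 0)) (D-* y (tail F ∘ y)))
      (≈-trans (+-congˡ {# 0} (+-congʳ {y * scaled s θ (tail F ∘ y)} (*-congʳ {tail F ∘ y} ∂y)))
        (solve 4 (λ τ y f f₁ → const 0ℚ :+ (τ :* y :* f :+ y :* f₁) := y :* (τ :* f) :+ y :* f₁) ≈-refl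
          τ y (tail F ∘ y) (scaled s θ (tail F ∘ y)))))))
    (λ F → ≈-trans (*-congˡ {τ} (≈-trans (∘-unfold (θ F))
        (+-cong (θ-head F) (*-congˡ {y} (≈-trans (∘-cong (tail-θ F)) (∘-+ (θ (tail F)) (tail F)))))))
      (solve 4 (λ τ y f f₁ → τ :* (const 0ℚ :+ y :* (f₁ :+ f)) := y :* (τ :* f) :+ y :* (τ :* f₁)) ≈-refl
        τ y (tail F ∘ y) (θ (tail F) ∘ y)))
    where
    open SeriesSolver using (solve; const; _:+_; _:*_; _:=_)
    open IsDerivation (scaled-isDerivation θ-isDerivation s)
    θ-head : ∀ F → con (θ F 0) ≈ # 0
    θ-head F n = cong (λ q → con q n) (ℚ.*-zeroˡ (F 0))

-- Geometric coefficient bounds and convergence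

module ℕSolver where
  open ℕ.+-*-Solver public using (solve; _:=_; _:+_; _:*_; _:^_) renaming (con to const)

ι-mono-≤ : ∀ {m n} → m ℕ.≤ n → ι m ℚ.≤ ι n
ι-mono-≤ {m} {n} m≤n = ℚ.toℚᵘ-cancel-≤ (begin
  toℚᵘ (ι m)            ≃⟨ ι-fraction m ⟩
  ℚᵘ.mkℚᵘ (+ m) 0       ≤⟨ ℚᵘ.*≤* (ℤ.*-monoʳ-≤-nonNeg (+ 1) (ℤ.+≤+ m≤n)) ⟩
  ℚᵘ.mkℚᵘ (+ n) 0       ≃⟨ ι-fraction n ⟨
  toℚᵘ (ι n)            ∎)
  where open ℚᵘ.≤-Reasoning

0≤ι : ∀ n → 0ℚ ℚ.≤ ι n
0≤ι n = ι-mono-≤ {0} {n} z≤n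

∣ι∣ : ∀ n → ℚ.∣ ι n ∣ ≡ ι n
∣ι∣ n = ℚ.0≤p⇒∣p∣≡p (0≤ι n)

*-mono-≤-nonNeg : ∀ {p q r s} → 0ℚ ℚ.≤ p → 0ℚ ℚ.≤ r → p ℚ.≤ q → r ℚ.≤ s → p ℚ.* r ℚ.≤ q ℚ.* s
*-mono-≤-nonNeg {p} {q} {r} {s} 0≤p 0≤r p≤q r≤s = ℚ.≤-trans
  (ℚ.*-monoʳ-≤-nonNeg r {{ℚ.nonNegative 0≤r}} p≤q)
  (ℚ.*-monoˡ-≤-nonNeg q {{ℚ.nonNegative (ℚ.≤-trans 0≤p p≤q)}} r≤s)

∣p*q∣≤ : ∀ {p q} m n → ℚ.∣ p ∣ ℚ.≤ ι m → ℚ.∣ q ∣ ℚ.≤ ι n → ℚ.∣ p ℚ.* q ∣ ℚ.≤ ι (m ℕ.* n)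
∣p*q∣≤ {p} {q} m n p≤ q≤ = begin
  ℚ.∣ p ℚ.* q ∣            ≡⟨ ℚ.∣p*q∣≡∣p∣*∣q∣ p q ⟩
  ℚ.∣ p ∣ ℚ.* ℚ.∣ q ∣      ≤⟨ *-mono-≤-nonNeg (ℚ.0≤∣p∣ p) (ℚ.0≤∣p∣ q) p≤ q≤ ⟩
  ι m ℚ.* ι n              ≡⟨ ι-* m n ⟨
  ι (m ℕ.* n)              ∎
  where open ℚ.≤-Reasoning

∣p+q∣≤ : ∀ {p q} m n → ℚ.∣ p ∣ ℚ.≤ ι m → ℚ.∣ q ∣ ℚ.≤ ι n → ℚ.∣ p ℚ.+ q ∣ ℚ.≤ ι (m ℕ.+ n)
∣p+q∣≤ {p} {q} m n p≤ q≤ = begin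
  ℚ.∣ p ℚ.+ q ∣            ≤⟨ ℚ.∣p+q∣≤∣p∣+∣q∣ p q ⟩
  ℚ.∣ p ∣ ℚ.+ ℚ.∣ q ∣      ≤⟨ ℚ.+-mono-≤ p≤ q≤ ⟩
  ι m ℚ.+ ι n              ≡⟨ ι-+ m n ⟨
  ι (m ℕ.+ n)              ∎
  where open ℚ.≤-Reasoning

∣-p∣≤ : ∀ {p r} → ℚ.∣ p ∣ ℚ.≤ r → ℚ.∣ ℚ.- p ∣ ℚ.≤ r
∣-p∣≤ {p} = subst (ℚ._≤ _) (sym (ℚ.∣-p∣≡∣p∣ p))

convergent-neg : ∀ {f} → Convergent f → Convergent (neg f)
convergent-neg (M , K , f≤) = M , K , λ n → ∣-p∣≤ (f≤ n)

convergent-+ : ∀ {f h} → Convergent f → Convergent h → Convergent (f + h)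
convergent-+ (M , K , f≤) (M′ , K′ , h≤) = M ℕ.+ M′ , K ℕ.+ K′ , λ n →
  ℚ.≤-trans (∣p+q∣≤ (M ℕ.* K ℕ.^ n) (M′ ℕ.* K′ ℕ.^ n) (f≤ n) (h≤ n)) (ι-mono-≤ (begin
    M ℕ.* K ℕ.^ n ℕ.+ M′ ℕ.* K′ ℕ.^ n
      ≤⟨ ℕ.+-mono-≤ (ℕ.*-monoʳ-≤ M (ℕ.^-monoˡ-≤ n (ℕ.m≤m+n K K′))) (ℕ.*-monoʳ-≤ M′ (ℕ.^-monoˡ-≤ n (ℕ.m≤n+m K′ K))) ⟩
    M ℕ.* (K ℕ.+ K′) ℕ.^ n ℕ.+ M′ ℕ.* (K ℕ.+ K′) ℕ.^ n
      ≡⟨ ℕ.*-distribʳ-+ ((K ℕ.+ K′) ℕ.^ n) M M′ ⟨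
    (M ℕ.+ M′) ℕ.* (K ℕ.+ K′) ℕ.^ n ∎))
  where open ℕ.≤-Reasoning

convergent-minus : ∀ {f h} → Convergent f → Convergent h → Convergent (f - h)
convergent-minus f h = convergent-+ f (convergent-neg h)

-- The denominator is at least 1, so the absolute value of the numerator is a bound.
convergent-con : ∀ q → Convergent (con q)
convergent-con q@(ℚ.mkℚ i _ _) = ℤ.∣ i ∣ , 1 , λ
  { zero    → subst (λ m → ℚ.∣ q ∣ ℚ.≤ ι m) (sym (ℕ.*-identityʳ ℤ.∣ i ∣)) (ℚ.toℚᵘ-cancel-≤ (bound i _))
  ; (suc n) → 0≤ι (ℤ.∣ i ∣ ℕ.* 1 ℕ.^ suc n) }
  where
  bound : ∀ i d → ℚᵘ.mkℚᵘ (+ ℤ.∣ i ∣) d ℚᵘ.≤ toℚᵘ (ι ℤ.∣ i ∣)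
  bound i d = ℚᵘ.≤-respʳ-≃ (ℚᵘ.≃-sym (ι-fraction ℤ.∣ i ∣))
    (ℚᵘ.*≤* (ℤ.*-monoˡ-≤-nonNeg (+ ℤ.∣ i ∣) (ℤ.+≤+ (s≤s z≤n))))

convergent-X : Convergent X
convergent-X = 1 , 1 , λ
  { zero          → 0≤ι 1
  ; (suc zero)    → ℚ.≤-refl
  ; (suc (suc n)) → 0≤ι (1 ℕ.* 1 ℕ.^ suc (suc n)) }

-- The sum of Kⁱ K′ⁿ⁻ⁱ is at most (K + K′)ⁿ, so no factor n + 1 arises. In the induction the tail of
-- `f` is bounded with `M * K` in place of `M`.
∣f*h∣≤ : ∀ M K M′ K′ f h → (∀ n → ℚ.∣ f n ∣ ℚ.≤ ι (M ℕ.* K ℕ.^ n)) → (∀ n → ℚ.∣ h n ∣ ℚ.≤ ι (M′ ℕ.* K′ ℕ.^ n)) →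
  ∀ n → ℚ.∣ (f * h) n ∣ ℚ.≤ ι (M ℕ.* M′ ℕ.* (K ℕ.+ K′) ℕ.^ n)
∣f*h∣≤ M K M′ K′ f h f≤ h≤ zero = begin
  ℚ.∣ f 0 ℚ.* h 0 ℚ.+ 0ℚ ∣   ≡⟨ cong ℚ.∣_∣ (ℚ.+-identityʳ (f 0 ℚ.* h 0)) ⟩
  ℚ.∣ f 0 ℚ.* h 0 ∣          ≤⟨ ∣p*q∣≤ (M ℕ.* 1) (M′ ℕ.* 1) (f≤ 0) (h≤ 0) ⟩
  ι (M ℕ.* 1 ℕ.* (M′ ℕ.* 1)) ≡⟨ cong ι (solve 2 (λ m m′ → m :* const 1 :* (m′ :* const 1) := m :* m′ :* const 1) refl M M′) ⟩
  ι (M ℕ.* M′ ℕ.* 1)         ∎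
  where
  open ℚ.≤-Reasoning
  open ℕSolver
∣f*h∣≤ M K M′ K′ f h f≤ h≤ (suc n) = begin
  ℚ.∣ f 0 ℚ.* h (suc n) ℚ.+ (tail f * h) n ∣
    ≤⟨ ∣p+q∣≤ (M ℕ.* 1 ℕ.* (M′ ℕ.* K′ ℕ.^ suc n)) (M ℕ.* K ℕ.* M′ ℕ.* (K ℕ.+ K′) ℕ.^ n)
          (∣p*q∣≤ (M ℕ.* 1) (M′ ℕ.* K′ ℕ.^ suc n) (f≤ 0) (h≤ (suc n))) (∣f*h∣≤ (M ℕ.* K) K M′ K′ (tail f) h tail≤ h≤ n) ⟩
  ι (M ℕ.* 1 ℕ.* (M′ ℕ.* (K′ ℕ.* K′ ℕ.^ n)) ℕ.+ M ℕ.* K ℕ.* M′ ℕ.* (K ℕ.+ K′) ℕ.^ n)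
    ≤⟨ ι-mono-≤ (ℕ.+-monoˡ-≤ (M ℕ.* K ℕ.* M′ ℕ.* (K ℕ.+ K′) ℕ.^ n)
         (ℕ.*-monoʳ-≤ (M ℕ.* 1) (ℕ.*-monoʳ-≤ M′ (ℕ.*-monoʳ-≤ K′ (ℕ.^-monoˡ-≤ n (ℕ.m≤n+m K′ K)))))) ⟩
  ι (M ℕ.* 1 ℕ.* (M′ ℕ.* (K′ ℕ.* (K ℕ.+ K′) ℕ.^ n)) ℕ.+ M ℕ.* K ℕ.* M′ ℕ.* (K ℕ.+ K′) ℕ.^ n)
    ≡⟨ cong ι (solve 5 (λ m m′ k k′ e →
         m :* const 1 :* (m′ :* (k′ :* e)) :+ m :* k :* m′ :* e := m :* m′ :* ((k :+ k′) :* e))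
         refl M M′ K K′ ((K ℕ.+ K′) ℕ.^ n)) ⟩
  ι (M ℕ.* M′ ℕ.* ((K ℕ.+ K′) ℕ.* (K ℕ.+ K′) ℕ.^ n)) ∎
  where
  open ℚ.≤-Reasoning
  open ℕSolver
  tail≤ : ∀ n → ℚ.∣ tail f n ∣ ℚ.≤ ι (M ℕ.* K ℕ.* K ℕ.^ n)
  tail≤ n = subst (λ m → ℚ.∣ tail f n ∣ ℚ.≤ ι m) (sym (ℕ.*-assoc M K (K ℕ.^ n))) (f≤ (suc n))

convergent-* : ∀ {f h} → Convergent f → Convergent h → Convergent (f * h)
convergent-* {f} {h} (M , K , f≤) (M′ , K′ , h≤) = M ℕ.* M′ , K ℕ.+ K′ , ∣f*h∣≤ M K M′ K′ f h f≤ h≤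

convergent-^ : ∀ {f} k → Convergent f → Convergent (f ^ k)
convergent-^ zero    f = convergent-con 1ℚ
convergent-^ (suc k) f = convergent-* f (convergent-^ k f)

-- Lets a recurrence with leading coefficient N be estimated without dividing by N.
∣p∣≤-by-multiple : ∀ N .{{_ : ℕ.NonZero N}} {p} M → ℚ.∣ ι N ℚ.* p ∣ ℚ.≤ ι (N ℕ.* M) → ℚ.∣ p ∣ ℚ.≤ ι M
∣p∣≤-by-multiple (suc N) {p} M Np≤ = ℚ.*-cancelˡ-≤-pos (ι (suc N)) {{positive}} (begin
  ι (suc N) ℚ.* ℚ.∣ p ∣        ≡⟨ cong (ℚ._* ℚ.∣ p ∣) (∣ι∣ (suc N)) ⟨
  ℚ.∣ ι (suc N) ∣ ℚ.* ℚ.∣ p ∣  ≡⟨ ℚ.∣p*q∣≡∣p∣*∣q∣ (ι (suc N)) p ⟨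
  ℚ.∣ ι (suc N) ℚ.* p ∣        ≤⟨ Np≤ ⟩
  ι (suc N ℕ.* M)              ≡⟨ ι-* (suc N) M ⟩
  ι (suc N) ℚ.* ι M            ∎)
  where
  open ℚ.≤-Reasoning
  positive : ℚ.Positive (ι (suc N))
  positive = ℚ.normalize-pos (suc N) 1

-- √(1 - 32x), as the solution of (1 - 32x) θs = -16xs.
√g : Series
√g zero    = 1ℚ
√g (suc n) = (+ 1 / suc n) ℚ.* ((ι 32 ℚ.* ι n ℚ.- ι 16) ℚ.* √g n)

reciprocal-multiple : ∀ N .{{_ : ℕ.NonZero N}} q → ι N ℚ.* ((+ 1 / N) ℚ.* q) ≡ q
reciprocal-multiple N q = trans (sym (ℚ.*-assoc (ι N) (+ 1 / N) q))
  (trans (cong (ℚ._* q) (ι-reciprocal N)) (ℚ.*-identityˡ q))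

-- The ratio of consecutive terms is (32n - 16)/(n + 1), of absolute value at most 32 since 32n + 16
-- ≤ 32(n + 1).
∣√g∣≤ : ∀ n → ℚ.∣ √g n ∣ ℚ.≤ ι (1 ℕ.* 32 ℕ.^ n)
∣√g∣≤ zero    = ℚ.≤-refl
∣√g∣≤ (suc n) = ∣p∣≤-by-multiple (suc n) (1 ℕ.* 32 ℕ.^ suc n) (subst (λ q → ℚ.∣ q ∣ ℚ.≤ ι (suc n ℕ.* (1 ℕ.* 32 ℕ.^ suc n)))
  (sym (reciprocal-multiple (suc n) _)) (begin
  ℚ.∣ (ι 32 ℚ.* ι n ℚ.- ι 16) ℚ.* √g n ∣
    ≤⟨ ∣p*q∣≤ (32 ℕ.* n ℕ.+ 16) (1 ℕ.* 32 ℕ.^ n) (∣p+q∣≤ {ι 32 ℚ.* ι n} (32 ℕ.* n) 16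
         (subst (λ q → ℚ.∣ q ∣ ℚ.≤ ι (32 ℕ.* n)) (ι-* 32 n) (ℚ.≤-reflexive (∣ι∣ (32 ℕ.* n)))) ℚ.≤-refl) (∣√g∣≤ n) ⟩
  ι ((32 ℕ.* n ℕ.+ 16) ℕ.* (1 ℕ.* 32 ℕ.^ n))
    ≤⟨ ι-mono-≤ (ℕ.m≤m+n ((32 ℕ.* n ℕ.+ 16) ℕ.* (1 ℕ.* 32 ℕ.^ n)) (16 ℕ.* 32 ℕ.^ n)) ⟩
  ι ((32 ℕ.* n ℕ.+ 16) ℕ.* (1 ℕ.* 32 ℕ.^ n) ℕ.+ 16 ℕ.* 32 ℕ.^ n)
    ≡⟨ cong ι (solve 2 (λ n e → (const 32 :* n :+ const 16) :* (const 1 :* e) :+ const 16 :* e :=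
         (const 1 :+ n) :* (const 1 :* (const 32 :* e))) refl n (32 ℕ.^ n)) ⟩
  ι (suc n ℕ.* (1 ℕ.* 32 ℕ.^ suc n)) ∎))
  where
  open ℚ.≤-Reasoning
  open ℕSolver

[1+4X]⁻¹ : Series
[1+4X]⁻¹ zero    = 1ℚ
[1+4X]⁻¹ (suc n) = (ℚ.- ι 4) ℚ.* [1+4X]⁻¹ n

∣[1+4X]⁻¹∣≤ : ∀ n → ℚ.∣ [1+4X]⁻¹ n ∣ ℚ.≤ ι (1 ℕ.* 4 ℕ.^ n)
∣[1+4X]⁻¹∣≤ zero    = ℚ.≤-refl
∣[1+4X]⁻¹∣≤ (suc n) = subst (λ m → ℚ.∣ [1+4X]⁻¹ (suc n) ∣ ℚ.≤ ι m)
  (solve 1 (λ e → const 4 :* (const 1 :* e) := const 1 :* (const 4 :* e)) refl (4 ℕ.^ n))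
  (∣p*q∣≤ {ℚ.- ι 4} 4 (1 ℕ.* 4 ℕ.^ n) ℚ.≤-refl (∣[1+4X]⁻¹∣≤ n))
  where open ℕSolver

-- Level 3: recurrence and growth of the binomial coefficients

binomial-factorials : ∀ {n k} → k ℕ.≤ n → (n C k) ℕ.* (k ! ℕ.* (n ℕ.∸ k) !) ≡ n !
binomial-factorials {n} {k} k≤n = trans
  (cong (ℕ._* (k ! ℕ.* (n ℕ.∸ k) !)) (nCk≡n!/k![n-k]! k≤n))
  (m/n*n≡m {{k ℕ.!* (n ℕ.∸ k) !≢0}} (k![n∸k]!∣n! k≤n))

t₃ : ℕ → ℕ
t₃ n = ((3 ℕ.* n) C n) ℕ.* ((2 ℕ.* n) C n) ℕ.^ 2

-- The quotient (3n)! (2n)! / n!⁵ with its denominator cleared, so that consecutive terms can be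
-- compared within ℕ.
t₃-factorials : ∀ n → t₃ n ℕ.* (n !) ℕ.^ 5 ≡ (3 ℕ.* n) ! ℕ.* (2 ℕ.* n) !
t₃-factorials n = begin
  A ℕ.* B ℕ.^ 2 ℕ.* (n !) ℕ.^ 5
    ≡⟨ solve 3 (λ a b f → a :* b :^ 2 :* f :^ 5 := a :* (f :* (b :* (f :* f))) :* (b :* (f :* f))) refl A B (n !) ⟩
  A ℕ.* (n ! ℕ.* (B ℕ.* (n ! ℕ.* n !))) ℕ.* (B ℕ.* (n ! ℕ.* n !))
    ≡⟨ cong (λ m → A ℕ.* (n ! ℕ.* m) ℕ.* m) B-factorials ⟩
  A ℕ.* (n ! ℕ.* (2 ℕ.* n) !) ℕ.* (2 ℕ.* n) !
    ≡⟨ cong (ℕ._* (2 ℕ.* n) !) (subst (λ m → A ℕ.* (n ! ℕ.* m !) ≡ (3 ℕ.* n) !) (ℕ.m+n∸m≡n n (2 ℕ.* n))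
         (binomial-factorials (ℕ.m≤m+n n (2 ℕ.* n)))) ⟩
  (3 ℕ.* n) ! ℕ.* (2 ℕ.* n) ! ∎
  where
  open ≡-Reasoning
  open ℕSolver
  A B : ℕ
  A = (3 ℕ.* n) C n
  B = (2 ℕ.* n) C n
  B-factorials : B ℕ.* (n ! ℕ.* n !) ≡ (2 ℕ.* n) !
  B-factorials = subst (λ m → B ℕ.* (n ! ℕ.* m !) ≡ (2 ℕ.* n) !)
    (trans (ℕ.m+n∸m≡n n (n ℕ.+ 0)) (ℕ.+-identityʳ n)) (binomial-factorials (ℕ.m≤m+n n (n ℕ.+ 0)))

-- The cubic is 6(2n + 1)(3n + 1)(3n + 2) in Horner form: the new factors of (3n + 3)! (2n + 2)!
-- after two factors n + 1 are split off.
t₃-recurrence : ∀ n → suc n ℕ.^ 3 ℕ.* t₃ (suc n) ≡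
  (12 ℕ.+ n ℕ.* (78 ℕ.+ n ℕ.* (162 ℕ.+ n ℕ.* 108))) ℕ.* t₃ n
t₃-recurrence n = ℕ.*-cancelʳ-≡ _ _ (suc n ℕ.^ 2 ℕ.* (n !) ℕ.^ 5)
  {{ℕ.m*n≢0 (suc n ℕ.^ 2) ((n !) ℕ.^ 5) {{_}} {{ℕ.m^n≢0 (n !) 5 {{n ℕ.!≢0}}}}}} (begin
  suc n ℕ.^ 3 ℕ.* t₃ (suc n) ℕ.* (suc n ℕ.^ 2 ℕ.* (n !) ℕ.^ 5)
    ≡⟨ solve 3 (λ N t f → N :^ 3 :* t :* (N :^ 2 :* f :^ 5) := t :* (N :* f) :^ 5) refl (suc n) (t₃ (suc n)) (n !) ⟩
  t₃ (suc n) ℕ.* (suc n !) ℕ.^ 5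
    ≡⟨ t₃-factorials (suc n) ⟩
  (3 ℕ.* suc n) ! ℕ.* (2 ℕ.* suc n) !
    ≡⟨ cong₂ (λ m k → m ! ℕ.* k !) (ℕ.*-suc 3 n) (ℕ.*-suc 2 n) ⟩
  (3 ℕ.+ 3 ℕ.* n) ! ℕ.* (2 ℕ.+ 2 ℕ.* n) !
    ≡⟨ solve 3 (λ n f h →
         (const 3 :+ const 3 :* n) :* ((const 2 :+ const 3 :* n) :* ((const 1 :+ const 3 :* n) :* f))
           :* ((const 2 :+ const 2 :* n) :* ((const 1 :+ const 2 :* n) :* h)) :=
         (const 12 :+ n :* (const 78 :+ n :* (const 162 :+ n :* const 108))) :* (const 1 :+ n) :^ 2 :* (f :* h))
         refl n ((3 ℕ.* n) !) ((2 ℕ.* n) !) ⟩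
  p ℕ.* suc n ℕ.^ 2 ℕ.* ((3 ℕ.* n) ! ℕ.* (2 ℕ.* n) !)
    ≡⟨ cong (p ℕ.* suc n ℕ.^ 2 ℕ.*_) (t₃-factorials n) ⟨
  p ℕ.* suc n ℕ.^ 2 ℕ.* (t₃ n ℕ.* (n !) ℕ.^ 5)
    ≡⟨ solve 4 (λ p N t f → p :* N :* (t :* f) := p :* t :* (N :* f)) refl p (suc n ℕ.^ 2) (t₃ n) ((n !) ℕ.^ 5) ⟩
  p ℕ.* t₃ n ℕ.* (suc n ℕ.^ 2 ℕ.* (n !) ℕ.^ 5) ∎)
  where
  open ≡-Reasoning
  open ℕSolver
  p : ℕ
  p = 12 ℕ.+ n ℕ.* (78 ℕ.+ n ℕ.* (162 ℕ.+ n ℕ.* 108))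

-- The base 360 is generous: 360(n + 1)³ exceeds the cubic of the recurrence coefficient by
-- coefficient, and `r` is the difference.
t₃≤360^ : ∀ n → t₃ n ℕ.≤ 1 ℕ.* 360 ℕ.^ n
t₃≤360^ zero    = ℕ.≤-refl
t₃≤360^ (suc n) = ℕ.*-cancelˡ-≤ (suc n ℕ.^ 3) (begin
  suc n ℕ.^ 3 ℕ.* t₃ (suc n)
    ≡⟨ t₃-recurrence n ⟩
  p ℕ.* t₃ n
    ≤⟨ ℕ.*-monoʳ-≤ p (t₃≤360^ n) ⟩
  p ℕ.* (1 ℕ.* 360 ℕ.^ n)
    ≤⟨ ℕ.m≤m+n _ (r ℕ.* 360 ℕ.^ n) ⟩
  p ℕ.* (1 ℕ.* 360 ℕ.^ n) ℕ.+ r ℕ.* 360 ℕ.^ n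
    ≡⟨ solve 2 (λ n e →
         (const 12 :+ n :* (const 78 :+ n :* (const 162 :+ n :* const 108))) :* (const 1 :* e)
           :+ (const 348 :+ n :* (const 1002 :+ n :* (const 918 :+ n :* const 252))) :* e :=
         (const 1 :+ n) :^ 3 :* (const 1 :* (const 360 :* e))) refl n (360 ℕ.^ n) ⟩
  suc n ℕ.^ 3 ℕ.* (1 ℕ.* 360 ℕ.^ suc n) ∎)
  where
  open ℕ.≤-Reasoning
  open ℕSolver
  p r : ℕ
  p = 12 ℕ.+ n ℕ.* (78 ℕ.+ n ℕ.* (162 ℕ.+ n ℕ.* 108))
  r = 348 ℕ.+ n ℕ.* (1002 ℕ.+ n ℕ.* (918 ℕ.+ n ℕ.* 252))

-- Level 6: recurrence and growth of `T₆`

ι-cubic : ∀ a b c d n → ι (a ℕ.+ n ℕ.* (b ℕ.+ n ℕ.* (c ℕ.+ n ℕ.* d))) ≡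
  ι a ℚ.+ ι n ℚ.* (ι b ℚ.+ ι n ℚ.* (ι c ℚ.+ ι n ℚ.* ι d))
ι-cubic a b c d n =
  horner a _ (horner b _ (horner c _ refl))
  where
  horner : ∀ a m {p} → ι m ≡ p → ι (a ℕ.+ n ℕ.* m) ≡ ι a ℚ.+ ι n ℚ.* p
  horner a m m≡p = trans (ι-+ a (n ℕ.* m)) (cong (ι a ℚ.+_) (trans (ι-* n m) (cong (ι n ℚ.*_) m≡p)))

-- The weights multiplied out: `weight n 1` is (2n + 1)(14n(n + 1) + 4) and `weight (suc n) 2` is
-- 32(n + 1)(2n + 1)(2n + 3). Being natural numbers, they are their own absolute values in the
-- estimate.
ω₁ ω₂ : ℕ → ℕ
ω₁ n = 4 ℕ.+ n ℕ.* (22 ℕ.+ n ℕ.* (42 ℕ.+ n ℕ.* 28))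
ω₂ n = 32 ℕ.* (3 ℕ.+ n ℕ.* (11 ℕ.+ n ℕ.* (12 ℕ.+ n ℕ.* 4)))

ι-ω₂ : ∀ n → ι (ω₂ n) ≡ ι 32 ℚ.* (ι 3 ℚ.+ ι n ℚ.* (ι 11 ℚ.+ ι n ℚ.* (ι 12 ℚ.+ ι n ℚ.* ι 4)))
ι-ω₂ n = trans (ι-* 32 (3 ℕ.+ n ℕ.* (11 ℕ.+ n ℕ.* (12 ℕ.+ n ℕ.* 4))))
  (cong (ι 32 ℚ.*_) (ι-cubic 3 11 12 4 n))

weight₁ : ∀ n → weight n 1 ≡ ι (ω₁ n)
weight₁ n = trans
  (cong (λ N → (N ℚ.- + 1 / 2) ℚ.* (hs 1 ℚ.- N ℚ.* (N ℚ.- ι 1) ℚ.* gs 1)) (ι-suc n))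
  (trans (solve 1 (λ m →
      (const 1ℚ :+ m :- const (+ 1 / 2)) :*
        (const (hs 1) :- (const 1ℚ :+ m) :* (const 1ℚ :+ m :- const (ι 1)) :* const (gs 1)) :=
      const (ι 4) :+ m :* (const (ι 22) :+ m :* (const (ι 42) :+ m :* const (ι 28))))
      refl (ι n))
    (sym (ι-cubic 4 22 42 28 n)))
  where open ℚSolver

weight₂ : ∀ n → weight (suc n) 2 ≡ ι (ω₂ n)
weight₂ n = trans
  (cong (λ N → (N ℚ.- + 2 / 2) ℚ.* (hs 2 ℚ.- N ℚ.* (N ℚ.- ι 2) ℚ.* gs 2)) (ι-+ 2 n))
  (trans (solve 1 (λ m →
      (const (ι 2) :+ m :- const (+ 2 / 2)) :*
        (const (hs 2) :- (const (ι 2) :+ m) :* (const (ι 2) :+ m :- const (ι 2)) :* const (gs 2)) :=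
      const (ι 32) :* (const (ι 3) :+ m :* (const (ι 11) :+ m :* (const (ι 12) :+ m :* const (ι 4)))))
      refl (ι n))
    (sym (ι-ω₂ n)))
  where open ℚSolver

T₆-recurrence : ∀ n → ι (suc (suc n) ℕ.^ 3) ℚ.* T₆ (suc (suc n)) ≡
  ι (ω₁ (suc n)) ℚ.* T₆ (suc n) ℚ.+ ι (ω₂ n) ℚ.* T₆ n
T₆-recurrence n = trans
  (reciprocal-multiple (suc (suc n) ℕ.^ 3) (weight (suc n) 1 ℚ.* T₆ (suc n) ℚ.+ weight (suc n) 2 ℚ.* T₆ n))
  (cong₂ (λ p q → p ℚ.* T₆ (suc n) ℚ.+ q ℚ.* T₆ n) (weight₁ (suc n)) (weight₂ n))

recurrence-bound : ∀ N .{{_ : ℕ.NonZero N}} a b {p q r} A B L → ι N ℚ.* p ≡ ι a ℚ.* q ℚ.+ ι b ℚ.* r →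
  ℚ.∣ q ∣ ℚ.≤ ι A → ℚ.∣ r ∣ ℚ.≤ ι B → a ℕ.* A ℕ.+ b ℕ.* B ℕ.≤ N ℕ.* L → ℚ.∣ p ∣ ℚ.≤ ι L
recurrence-bound N a b {p} {q} {r} A B L recurrence q≤ r≤ bound = ∣p∣≤-by-multiple N L (begin
  ℚ.∣ ι N ℚ.* p ∣                  ≡⟨ cong ℚ.∣_∣ recurrence ⟩
  ℚ.∣ ι a ℚ.* q ℚ.+ ι b ℚ.* r ∣    ≤⟨ ∣p+q∣≤ (a ℕ.* A) (b ℕ.* B)
                                        (∣p*q∣≤ a A (ℚ.≤-reflexive (∣ι∣ a)) q≤)
                                        (∣p*q∣≤ b B (ℚ.≤-reflexive (∣ι∣ b)) r≤) ⟩
  ι (a ℕ.* A ℕ.+ b ℕ.* B)          ≤⟨ ι-mono-≤ {a ℕ.* A ℕ.+ b ℕ.* B} {N ℕ.* L} bound ⟩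
  ι (N ℕ.* L)                      ∎)
  where open ℚ.≤-Reasoning

ω₁-bound : ∀ n → ω₁ n ℕ.≤ 28 ℕ.* (1 ℕ.+ n) ℕ.^ 3
ω₁-bound n = subst (ω₁ n ℕ.≤_)
  (solve 1 (λ n → const 4 :+ n :* (const 22 :+ n :* (const 42 :+ n :* const 28))
     :+ (const 24 :+ n :* (const 62 :+ n :* const 42)) := const 28 :* (const 1 :+ n) :^ 3) refl n)
  (ℕ.m≤m+n (ω₁ n) (24 ℕ.+ n ℕ.* (62 ℕ.+ n ℕ.* 42)))
  where open ℕSolver

ω₂-bound : ∀ n → ω₂ n ℕ.≤ 32 ℕ.* (4 ℕ.* (2 ℕ.+ n) ℕ.^ 3)
ω₂-bound n = ℕ.*-monoʳ-≤ 32 (subst (3 ℕ.+ n ℕ.* (11 ℕ.+ n ℕ.* (12 ℕ.+ n ℕ.* 4)) ℕ.≤_)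
  (solve 1 (λ n → const 3 :+ n :* (const 11 :+ n :* (const 12 :+ n :* const 4))
     :+ (const 29 :+ n :* (const 37 :+ n :* const 12)) := const 4 :* (const 2 :+ n) :^ 3) refl n)
  (ℕ.m≤m+n (3 ℕ.+ n ℕ.* (11 ℕ.+ n ℕ.* (12 ℕ.+ n ℕ.* 4))) (29 ℕ.+ n ℕ.* (37 ℕ.+ n ℕ.* 12))))
  where open ℕSolver

-- Used with k = 32, where it is the induction step of a bound by 32ⁿ: the number 32 is the positive
-- root of t² = 28t + 128, with 28 and 128 the leading coefficients of the two weights.
combined-bound : ∀ {a b} N k e → a ℕ.≤ 28 ℕ.* N → b ℕ.≤ k ℕ.* (4 ℕ.* N) →
  a ℕ.* (1 ℕ.* (k ℕ.* e)) ℕ.+ b ℕ.* (1 ℕ.* e) ℕ.≤ N ℕ.* (1 ℕ.* (32 ℕ.* (k ℕ.* e)))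
combined-bound {a} {b} N k e a≤ b≤ = subst (a ℕ.* (1 ℕ.* (k ℕ.* e)) ℕ.+ b ℕ.* (1 ℕ.* e) ℕ.≤_)
  (solve 3 (λ N k e → const 28 :* N :* (const 1 :* (k :* e)) :+ k :* (const 4 :* N) :* (const 1 :* e)
     := N :* (const 1 :* (const 32 :* (k :* e)))) refl N k e)
  (ℕ.+-mono-≤ (ℕ.*-monoˡ-≤ (1 ℕ.* (k ℕ.* e)) a≤) (ℕ.*-monoˡ-≤ (1 ℕ.* e) b≤))
  where open ℕSolver

∣T₆∣≤ : ∀ n → ℚ.∣ T₆ n ∣ ℚ.≤ ι (1 ℕ.* 32 ℕ.^ n)
∣T₆∣≤ zero          = ℚ.≤-refl
∣T₆∣≤ (suc zero)    = ι-mono-≤ {4} {32} (ℕ.m≤m+n 4 28)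
∣T₆∣≤ (suc (suc n)) = recurrence-bound (suc (suc n) ℕ.^ 3) (ω₁ (suc n)) (ω₂ n)
  (1 ℕ.* 32 ℕ.^ suc n) (1 ℕ.* 32 ℕ.^ n) (1 ℕ.* 32 ℕ.^ suc (suc n))
  (T₆-recurrence n) (∣T₆∣≤ (suc n)) (∣T₆∣≤ n) (combined-bound {ω₁ (suc n)} {ω₂ n} (suc (suc n) ℕ.^ 3) 32 (32 ℕ.^ n) (ω₁-bound (suc n)) (ω₂-bound n))

-- The linear equation as a recurrence for coefficients

module _ (g₁ g₂ h₁ h₂ : ℚ) where

  leading potential : Series
  leading   = # 1 + con g₁ * X + con g₂ * X ^ 2
  potential = con h₁ * X + con h₂ * X ^ 2

  shift₁ shift₂ : Series → Series
  shift₁ F = con g₁ * (# 2 * θ (θ (θ F)) + # 3 * θ (θ F) + θ F) - con h₁ * (# 2 * θ F + F)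
  shift₂ F = con g₂ * (# 2 * θ (θ (θ F)) + # 6 * θ (θ F) + # 4 * θ F) - con h₂ * (# 2 * θ F + # 2 * F)

  θ-leading : θ leading ≈ con g₁ * X + # 2 * con g₂ * X ^ 2
  θ-leading = differentiate θ-isDerivation
    (v 0 ∷ v 1 ∷ v 2 ∷ []) (v 0 ∷ const 0ℚ ∷ const 0ℚ ∷ []) (X ∷ con g₁ ∷ con g₂ ∷ []) (X ∷ con g₁ ∷ con g₂ ∷ [])
    (≈-refl ∷ ≈-refl ∷ ≈-refl ∷ []) (θX ∷ D-C g₁ ∷ D-C g₂ ∷ [])
    (const 1ℚ :+ v 1 :* v 0 :+ v 2 :* v 0 :^ 2) (v 1 :* v 0 :+ const (ι 2) :* v 2 :* v 0 :^ 2) ≈-refl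
    where
    open SeriesSolver
    open IsDerivation θ-isDerivation

  linear-expansion : ∀ F → linear θ leading potential F ≈
    # 2 * θ (θ (θ F)) + X * (shift₁ F + X * shift₂ F)
  linear-expansion F = begin
    θ (laplace θ leading F) - # 2 * potential * θ F - θ potential * F
      ≈⟨ +-cong (+-congʳ {neg (# 2 * potential * θ F)} θ-laplace) (-‿cong (*-congʳ {F} θ-potential)) ⟩
    _ ≈⟨ prove (X ∷ con g₁ ∷ con g₂ ∷ con h₁ ∷ con h₂ ∷ F ∷ θ F ∷ θ (θ F) ∷ θ (θ (θ F)) ∷ [])
           (laplace₁ :- const (ι 2) :* (v 3 :* v 0 :+ v 4 :* v 0 :^ 2) :* v 6
             :- (v 3 :* v 0 :+ const (ι 2) :* v 4 :* v 0 :^ 2) :* v 5)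
           (const (ι 2) :* v 8 :+ v 0 :*
             (v 1 :* (const (ι 2) :* v 8 :+ const (ι 3) :* v 7 :+ v 6) :- v 3 :* (const (ι 2) :* v 6 :+ v 5)
             :+ v 0 :* (v 2 :* (const (ι 2) :* v 8 :+ const (ι 6) :* v 7 :+ const (ι 4) :* v 6)
               :- v 4 :* (const (ι 2) :* v 6 :+ const (ι 2) :* v 5)))) ≈-refl ⟩
    # 2 * θ (θ (θ F)) + X * (shift₁ F + X * shift₂ F) ∎
    where
    open import Relation.Binary.Reasoning.Setoid setoid
    open SeriesSolver
    open IsDerivation θ-isDerivation
    θ-potential : θ potential ≈ con h₁ * X + # 2 * con h₂ * X ^ 2
    θ-potential = differentiate θ-isDerivation
      (v 0 ∷ v 1 ∷ v 2 ∷ []) (v 0 ∷ const 0ℚ ∷ const 0ℚ ∷ []) (X ∷ con h₁ ∷ con h₂ ∷ []) (X ∷ con h₁ ∷ con h₂ ∷ [])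
      (≈-refl ∷ ≈-refl ∷ ≈-refl ∷ []) (θX ∷ D-C h₁ ∷ D-C h₂ ∷ [])
      (v 1 :* v 0 :+ v 2 :* v 0 :^ 2) (v 1 :* v 0 :+ const (ι 2) :* v 2 :* v 0 :^ 2) ≈-refl
    laplace₁ : Polynomial 9
    laplace₁ = const (ι 2) :* (const 1ℚ :+ v 1 :* v 0 :+ v 2 :* v 0 :^ 2) :* v 8
      :+ const (ι 3) :* (v 1 :* v 0 :+ const (ι 2) :* v 2 :* v 0 :^ 2) :* v 7
      :+ (v 1 :* v 0 :+ const (ι 4) :* v 2 :* v 0 :^ 2) :* v 6
    θ-laplace : θ (laplace θ leading F) ≈
      ⟦ laplace₁ ⟧ (X ∷ con g₁ ∷ con g₂ ∷ con h₁ ∷ con h₂ ∷ F ∷ θ F ∷ θ (θ F) ∷ θ (θ (θ F)) ∷ [])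
    θ-laplace = ≈-trans
      (D-cong {laplace θ leading F} (+-congˡ {# 2 * leading * θ (θ F)} (*-congʳ {θ F} θ-leading)))
      (differentiate θ-isDerivation
        (v 0 ∷ v 1 ∷ v 2 ∷ v 6 ∷ v 7 ∷ []) (v 0 ∷ const 0ℚ ∷ const 0ℚ ∷ v 7 ∷ v 8 ∷ [])
        (X ∷ con g₁ ∷ con g₂ ∷ θ F ∷ θ (θ F) ∷ [])
        (X ∷ con g₁ ∷ con g₂ ∷ con h₁ ∷ con h₂ ∷ F ∷ θ F ∷ θ (θ F) ∷ θ (θ (θ F)) ∷ [])
        (≈-refl ∷ ≈-refl ∷ ≈-refl ∷ ≈-refl ∷ ≈-refl ∷ [])
        (θX ∷ D-C g₁ ∷ D-C g₂ ∷ ≈-refl ∷ ≈-refl ∷ [])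
        (const (ι 2) :* (const 1ℚ :+ v 1 :* v 0 :+ v 2 :* v 0 :^ 2) :* v 4
          :+ (v 1 :* v 0 :+ const (ι 2) :* v 2 :* v 0 :^ 2) :* v 3)
        laplace₁ ≈-refl)

  -- They factor as (2m + 1)(g₁ m(m + 1) - h₁) and 2(m + 1)(g₂ m(m + 2) - h₂). For the level 6
  -- constants these are -2 times `weight m 1` and `weight (suc m) 2`, so L(F) = 0 is twice the
  -- recurrence.
  symbol₁ symbol₂ : ℚ → ℚ
  symbol₁ m = g₁ ℚ.* (ι 2 ℚ.* m ℚ.* m ℚ.* m ℚ.+ ι 3 ℚ.* m ℚ.* m ℚ.+ m) ℚ.- h₁ ℚ.* (ι 2 ℚ.* m ℚ.+ ι 1)
  symbol₂ m = g₂ ℚ.* (ι 2 ℚ.* m ℚ.* m ℚ.* m ℚ.+ ι 6 ℚ.* m ℚ.* m ℚ.+ ι 4 ℚ.* m) ℚ.- h₂ ℚ.* (ι 2 ℚ.* m ℚ.+ ι 2)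

  shift₁-coefficient : ∀ F n → shift₁ F n ≡ symbol₁ (ι n) ℚ.* F n
  shift₁-coefficient F n = trans
    (cong₂ ℚ._-_
      (trans (con-* g₁ (# 2 * θ (θ (θ F)) + # 3 * θ (θ F) + θ F) n)
        (cong₂ (λ p q → g₁ ℚ.* (p ℚ.+ q ℚ.+ ι n ℚ.* F n)) (con-* (ι 2) (θ (θ (θ F))) n) (con-* (ι 3) (θ (θ F)) n)))
      (trans (con-* h₁ (# 2 * θ F + F) n) (cong (λ p → h₁ ℚ.* (p ℚ.+ F n)) (con-* (ι 2) (θ F) n))))
    (solve 4 (λ g h m f →
      g :* (const (ι 2) :* (m :* (m :* (m :* f))) :+ const (ι 3) :* (m :* (m :* f)) :+ m :* f)
        :- h :* (const (ι 2) :* (m :* f) :+ f) :=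
      (g :* (const (ι 2) :* m :* m :* m :+ const (ι 3) :* m :* m :+ m) :- h :* (const (ι 2) :* m :+ const (ι 1))) :* f)
      refl g₁ h₁ (ι n) (F n))
    where open ℚSolver

  shift₂-coefficient : ∀ F n → shift₂ F n ≡ symbol₂ (ι n) ℚ.* F n
  shift₂-coefficient F n = trans
    (cong₂ ℚ._-_
      (trans (con-* g₂ (# 2 * θ (θ (θ F)) + # 6 * θ (θ F) + # 4 * θ F) n)
        (trans (cong₂ (λ p q → g₂ ℚ.* (p ℚ.+ q ℚ.+ (# 4 * θ F) n)) (con-* (ι 2) (θ (θ (θ F))) n) (con-* (ι 6) (θ (θ F)) n))
          (cong (λ p → g₂ ℚ.* (ι 2 ℚ.* θ (θ (θ F)) n ℚ.+ ι 6 ℚ.* θ (θ F) n ℚ.+ p)) (con-* (ι 4) (θ F) n))))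
      (trans (con-* h₂ (# 2 * θ F + # 2 * F) n)
        (cong₂ (λ p q → h₂ ℚ.* (p ℚ.+ q)) (con-* (ι 2) (θ F) n) (con-* (ι 2) F n))))
    (solve 4 (λ g h m f →
      g :* (const (ι 2) :* (m :* (m :* (m :* f))) :+ const (ι 6) :* (m :* (m :* f)) :+ const (ι 4) :* (m :* f))
        :- h :* (const (ι 2) :* (m :* f) :+ const (ι 2) :* f) :=
      (g :* (const (ι 2) :* m :* m :* m :+ const (ι 6) :* m :* m :+ const (ι 4) :* m)
        :- h :* (const (ι 2) :* m :+ const (ι 2))) :* f)
      refl g₂ h₂ (ι n) (F n))
    where open ℚSolver

  private
    cube-coefficient : ∀ F n → (# 2 * θ (θ (θ F))) n ≡ ι 2 ℚ.* (ι n ℚ.* (ι n ℚ.* (ι n ℚ.* F n)))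
    cube-coefficient F n = con-* (ι 2) (θ (θ (θ F))) n

  linear-coefficient-0 : ∀ F → linear θ leading potential F 0 ≡ 0ℚ
  linear-coefficient-0 F = trans (linear-expansion F 0) (trans
    (cong₂ ℚ._+_ (cube-coefficient F 0) (X-*-zero (shift₁ F + X * shift₂ F)))
    (solve 1 (λ f → const (ι 2) :* (const 0ℚ :* (const 0ℚ :* (const 0ℚ :* f))) :+ const 0ℚ := const 0ℚ) refl (F 0)))
    where open ℚSolver

  linear-coefficient-1 : ∀ F → linear θ leading potential F 1 ≡ ι 2 ℚ.* F 1 ℚ.+ symbol₁ 0ℚ ℚ.* F 0
  linear-coefficient-1 F = trans (linear-expansion F 1) (trans
    (cong₂ ℚ._+_ (cube-coefficient F 1) (trans (X-*-suc (shift₁ F + X * shift₂ F) 0)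
      (cong₂ ℚ._+_ (shift₁-coefficient F 0) (X-*-zero (shift₂ F)))))
    (solve 2 (λ f s → const (ι 2) :* (const 1ℚ :* (const 1ℚ :* (const 1ℚ :* f))) :+ (s :+ const 0ℚ) := const (ι 2) :* f :+ s)
      refl (F 1) (symbol₁ 0ℚ ℚ.* F 0)))
    where open ℚSolver

  linear-coefficient-2+ : ∀ F n → linear θ leading potential F (suc (suc n)) ≡
    ι 2 ℚ.* (ι (suc (suc n)) ℚ.* (ι (suc (suc n)) ℚ.* (ι (suc (suc n)) ℚ.* F (suc (suc n)))))
      ℚ.+ (symbol₁ (ι (suc n)) ℚ.* F (suc n) ℚ.+ symbol₂ (ι n) ℚ.* F n)
  linear-coefficient-2+ F n = trans (linear-expansion F (suc (suc n)))
    (cong₂ ℚ._+_ (cube-coefficient F (suc (suc n))) (trans (X-*-suc (shift₁ F + X * shift₂ F) (suc n))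
      (cong₂ ℚ._+_ (shift₁-coefficient F (suc n)) (trans (X-*-suc (shift₂ F) n) (shift₂-coefficient F n)))))

-- The equations of levels 3 and 6

ι-cancel : ∀ N .{{_ : ℕ.NonZero N}} {p q} → ι N ℚ.* p ≡ ι N ℚ.* q → p ≡ q
ι-cancel N {p} {q} Np≡Nq = begin
  p                                ≡⟨ reciprocal N p ⟨
  (+ 1 / N) ℚ.* (ι N ℚ.* p)        ≡⟨ cong ((+ 1 / N) ℚ.*_) Np≡Nq ⟩
  (+ 1 / N) ℚ.* (ι N ℚ.* q)        ≡⟨ reciprocal N q ⟩
  q                                ∎
  where
  open ≡-Reasoning
  reciprocal : ∀ N .{{_ : ℕ.NonZero N}} q → (+ 1 / N) ℚ.* (ι N ℚ.* q) ≡ q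
  reciprocal N q = trans (sym (ℚ.*-assoc (+ 1 / N) (ι N) q))
    (trans (cong (ℚ._* q) (trans (ℚ.*-comm (+ 1 / N) (ι N)) (ι-reciprocal N))) (ℚ.*-identityˡ q))

θ-kernel : ∀ f → f 0 ≡ 0ℚ → θ f ≈ # 0 → f ≈ # 0
θ-kernel f f₀≡0 θf≈0 zero    = f₀≡0
θ-kernel f f₀≡0 θf≈0 (suc n) = ι-cancel (suc n) (trans (θf≈0 (suc n)) (sym (ℚ.*-zeroʳ (ι (suc n)))))

ι-cube : ∀ N → ι (N ℕ.^ 3) ≡ ι N ℚ.* (ι N ℚ.* ι N)
ι-cube N = trans (ι-* N (N ℕ.^ 2)) (cong (ι N ℚ.*_) (trans (ι-* N (N ℕ.^ 1)) (cong (λ m → ι N ℚ.* ι m) (ℕ.*-identityʳ N))))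

ι-recurrence : ∀ n t t′ → suc n ℕ.^ 3 ℕ.* t′ ≡ (12 ℕ.+ n ℕ.* (78 ℕ.+ n ℕ.* (162 ℕ.+ n ℕ.* 108))) ℕ.* t →
  ι (suc n) ℚ.* (ι (suc n) ℚ.* (ι (suc n) ℚ.* ι t′)) ≡
  (ι 12 ℚ.+ ι n ℚ.* (ι 78 ℚ.+ ι n ℚ.* (ι 162 ℚ.+ ι n ℚ.* ι 108))) ℚ.* ι t
ι-recurrence n t t′ eq = begin
  ι (suc n) ℚ.* (ι (suc n) ℚ.* (ι (suc n) ℚ.* ι t′))
    ≡⟨ solve 2 (λ N t → N :* (N :* (N :* t)) := N :* (N :* N) :* t) refl (ι (suc n)) (ι t′) ⟩
  ι (suc n) ℚ.* (ι (suc n) ℚ.* ι (suc n)) ℚ.* ι t′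
    ≡⟨ cong (ℚ._* ι t′) (ι-cube (suc n)) ⟨
  ι (suc n ℕ.^ 3) ℚ.* ι t′
    ≡⟨ ι-* (suc n ℕ.^ 3) t′ ⟨
  ι (suc n ℕ.^ 3 ℕ.* t′)
    ≡⟨ cong ι eq ⟩
  ι ((12 ℕ.+ n ℕ.* (78 ℕ.+ n ℕ.* (162 ℕ.+ n ℕ.* 108))) ℕ.* t)
    ≡⟨ ι-* (12 ℕ.+ n ℕ.* (78 ℕ.+ n ℕ.* (162 ℕ.+ n ℕ.* 108))) t ⟩
  ι (12 ℕ.+ n ℕ.* (78 ℕ.+ n ℕ.* (162 ℕ.+ n ℕ.* 108))) ℚ.* ι t
    ≡⟨ cong (ℚ._* ι t) (ι-cubic 12 78 162 108 n) ⟩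
  (ι 12 ℚ.+ ι n ℚ.* (ι 78 ℚ.+ ι n ℚ.* (ι 162 ℚ.+ ι n ℚ.* ι 108))) ℚ.* ι t ∎
  where
  open ≡-Reasoning
  open ℚSolver

T₃-recurrence : ∀ n → ι (suc n) ℚ.* (ι (suc n) ℚ.* (ι (suc n) ℚ.* T₃ (suc n))) ≡
  (ι 12 ℚ.+ ι n ℚ.* (ι 78 ℚ.+ ι n ℚ.* (ι 162 ℚ.+ ι n ℚ.* ι 108))) ℚ.* T₃ n
T₃-recurrence n = ι-recurrence n (t₃ n) (t₃ (suc n)) (t₃-recurrence n)

W₃ H₃ W₆ H₆ : Series
W₃ = leading (ℚ.- ι 108) 0ℚ (ι 24) 0ℚ
H₃ = potential (ℚ.- ι 108) 0ℚ (ι 24) 0ℚ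
W₆ = leading (gs 1) (gs 2) (hs 1) (hs 2)
H₆ = potential (gs 1) (gs 2) (hs 1) (hs 2)

F₃-linear : linear θ W₃ H₃ F₃ ≈ # 0
F₃-linear zero          = linear-coefficient-0 (ℚ.- ι 108) 0ℚ (ι 24) 0ℚ F₃
F₃-linear (suc zero)    = linear-coefficient-1 (ℚ.- ι 108) 0ℚ (ι 24) 0ℚ F₃
F₃-linear (suc (suc n)) = trans (linear-coefficient-2+ (ℚ.- ι 108) 0ℚ (ι 24) 0ℚ F₃ n) (trans
  (cong (λ p → ι 2 ℚ.* p ℚ.+ (symbol₁ (ℚ.- ι 108) 0ℚ (ι 24) 0ℚ (ι (suc n)) ℚ.* T₃ (suc n)
     ℚ.+ symbol₂ (ℚ.- ι 108) 0ℚ (ι 24) 0ℚ (ι n) ℚ.* T₃ n)) (T₃-recurrence (suc n)))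
  (solve 4 (λ N m t t′ →
    const (ι 2) :* ((const (ι 12) :+ N :* (const (ι 78) :+ N :* (const (ι 162) :+ N :* const (ι 108)))) :* t)
    :+ ((const (ℚ.- ι 108) :* (const (ι 2) :* N :* N :* N :+ const (ι 3) :* N :* N :+ N)
           :- const (ι 24) :* (const (ι 2) :* N :+ const (ι 1))) :* t
       :+ (const 0ℚ :* (const (ι 2) :* m :* m :* m :+ const (ι 6) :* m :* m :+ const (ι 4) :* m)
           :- const 0ℚ :* (const (ι 2) :* m :+ const (ι 2))) :* t′) := const 0ℚ)
    refl (ι (suc n)) (ι n) (T₃ (suc n)) (T₃ n)))
  where open ℚSolver

-- The first integral is constant since L(F₃) = 0, and the constant is 0: every term of Q contains a
-- θ-derivative or `H₃`, each zero at the origin. The `refl` computes this constant term.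
F₃-quadratic : quadratic θ W₃ H₃ F₃ ≈ # 0
F₃-quadratic = θ-kernel (quadratic θ W₃ H₃ F₃) refl
  (≈-trans (quadratic-integral θ-isDerivation W₃ H₃ F₃)
    (≈-trans (*-congˡ {# 2 * F₃} F₃-linear) (*-zeroʳ (# 2 * F₃))))

-- In coefficient N of L(F) the unknown `F N` is multiplied by 2N³, nonzero for N ≥ 1, so `F 0`
-- determines everything else.
F₆-unique : ∀ F → linear θ W₆ H₆ F ≈ # 0 → ∀ n → F n ≡ F 0 ℚ.* T₆ n
F₆-unique F LF≈0 zero          = sym (ℚ.*-identityʳ (F 0))
F₆-unique F LF≈0 (suc zero)    = begin
  F 1
    ≡⟨ solve 2 (λ f₁ f₀ → f₁ := const (+ 1 / 2) :* (const (ι 2) :* f₁ :+ const (symbol₁ (gs 1) (gs 2) (hs 1) (hs 2) 0ℚ) :* f₀)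
         :+ f₀ :* const (T₆ 1)) refl (F 1) (F 0) ⟩
  (+ 1 / 2) ℚ.* (ι 2 ℚ.* F 1 ℚ.+ symbol₁ (gs 1) (gs 2) (hs 1) (hs 2) 0ℚ ℚ.* F 0) ℚ.+ F 0 ℚ.* T₆ 1
    ≡⟨ cong (λ p → (+ 1 / 2) ℚ.* p ℚ.+ F 0 ℚ.* T₆ 1)
         (trans (sym (linear-coefficient-1 (gs 1) (gs 2) (hs 1) (hs 2) F)) (LF≈0 1)) ⟩
  0ℚ ℚ.+ F 0 ℚ.* T₆ 1
    ≡⟨ ℚ.+-identityˡ (F 0 ℚ.* T₆ 1) ⟩
  F 0 ℚ.* T₆ 1 ∎
  where
  open ≡-Reasoning
  open ℚSolver
F₆-unique F LF≈0 (suc (suc n)) = ι-cancel (N ℕ.^ 3) (begin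
  ι (N ℕ.^ 3) ℚ.* F N
    ≡⟨ cong (ℚ._* F N) (ι-cube N) ⟩
  ι N ℚ.* (ι N ℚ.* ι N) ℚ.* F N
    -- Half of coefficient N of L(F) is N³ `F N` plus half of `lower`; writing N³ `F N` as the
    -- difference lets L(F) = 0 be inserted.
    ≡⟨ solve 5 (λ N f m m′ r → N :* (N :* N) :* f :=
         const (+ 1 / 2) :* (const (ι 2) :* (N :* (N :* (N :* f))) :+ r) :- const (+ 1 / 2) :* r)
         refl (ι N) (F N) (ι (suc n)) (ι n) lower ⟩
  (+ 1 / 2) ℚ.* (ι 2 ℚ.* (ι N ℚ.* (ι N ℚ.* (ι N ℚ.* F N))) ℚ.+ lower) ℚ.- (+ 1 / 2) ℚ.* lower
    ≡⟨ cong (λ p → (+ 1 / 2) ℚ.* p ℚ.- (+ 1 / 2) ℚ.* lower)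
         (trans (sym (linear-coefficient-2+ (gs 1) (gs 2) (hs 1) (hs 2) F n)) (LF≈0 N)) ⟩
  0ℚ ℚ.- (+ 1 / 2) ℚ.* lower
    ≡⟨ cong₂ (λ p q → 0ℚ ℚ.- (+ 1 / 2) ℚ.* (symbol₁ (gs 1) (gs 2) (hs 1) (hs 2) (ι (suc n)) ℚ.* p
           ℚ.+ symbol₂ (gs 1) (gs 2) (hs 1) (hs 2) (ι n) ℚ.* q))
         (F₆-unique F LF≈0 (suc n)) (F₆-unique F LF≈0 n) ⟩
  0ℚ ℚ.- (+ 1 / 2) ℚ.* (symbol₁ (gs 1) (gs 2) (hs 1) (hs 2) (ι (suc n)) ℚ.* (F 0 ℚ.* T₆ (suc n))
    ℚ.+ symbol₂ (gs 1) (gs 2) (hs 1) (hs 2) (ι n) ℚ.* (F 0 ℚ.* T₆ n))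
    ≡⟨ solve 5 (λ m₁ m f t₁ t →
         const 0ℚ :- const (+ 1 / 2) :* (
           (const (gs 1) :* (const (ι 2) :* m₁ :* m₁ :* m₁ :+ const (ι 3) :* m₁ :* m₁ :+ m₁)
             :- const (hs 1) :* (const (ι 2) :* m₁ :+ const (ι 1))) :* (f :* t₁)
           :+ (const (gs 2) :* (const (ι 2) :* m :* m :* m :+ const (ι 6) :* m :* m :+ const (ι 4) :* m)
             :- const (hs 2) :* (const (ι 2) :* m :+ const (ι 2))) :* (f :* t)) :=
         f :* ((const (ι 4) :+ m₁ :* (const (ι 22) :+ m₁ :* (const (ι 42) :+ m₁ :* const (ι 28)))) :* t₁
           :+ const (ι 32) :* (const (ι 3) :+ m :* (const (ι 11) :+ m :* (const (ι 12) :+ m :* const (ι 4)))) :* t))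
         refl (ι (suc n)) (ι n) (F 0) (T₆ (suc n)) (T₆ n) ⟩
  F 0 ℚ.* ((ι 4 ℚ.+ ι (suc n) ℚ.* (ι 22 ℚ.+ ι (suc n) ℚ.* (ι 42 ℚ.+ ι (suc n) ℚ.* ι 28))) ℚ.* T₆ (suc n)
    ℚ.+ ι 32 ℚ.* (ι 3 ℚ.+ ι n ℚ.* (ι 11 ℚ.+ ι n ℚ.* (ι 12 ℚ.+ ι n ℚ.* ι 4))) ℚ.* T₆ n)
    ≡⟨ cong₂ (λ p q → F 0 ℚ.* (p ℚ.* T₆ (suc n) ℚ.+ q ℚ.* T₆ n))
         (trans (sym (ι-cubic 4 22 42 28 (suc n))) (sym (weight₁ (suc n))))
         (trans (sym (ι-ω₂ n)) (sym (weight₂ n))) ⟩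
  F 0 ℚ.* (weight (suc n) 1 ℚ.* T₆ (suc n) ℚ.+ weight (suc n) 2 ℚ.* T₆ n)
    ≡⟨ cong (F 0 ℚ.*_) (reciprocal-multiple (N ℕ.^ 3) _) ⟨
  F 0 ℚ.* (ι (N ℕ.^ 3) ℚ.* T₆ N)
    ≡⟨ solve 3 (λ f m t → f :* (m :* t) := m :* (f :* t)) refl (F 0) (ι (N ℕ.^ 3)) (T₆ N) ⟩
  ι (N ℕ.^ 3) ℚ.* (F 0 ℚ.* T₆ N) ∎)
  where
  open ≡-Reasoning
  open ℚSolver
  N : ℕ
  N = suc (suc n)
  lower : ℚ
  lower = symbol₁ (gs 1) (gs 2) (hs 1) (hs 2) (ι (suc n)) ℚ.* F (suc n)
    ℚ.+ symbol₂ (gs 1) (gs 2) (hs 1) (hs 2) (ι n) ℚ.* F n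

-- The series 1/(1 + 4x) and √(1 - 32x)

[1+4X]⁻¹-telescope : [1+4X]⁻¹ + X * (# 4 * [1+4X]⁻¹) ≈ # 1
[1+4X]⁻¹-telescope zero    = cong (1ℚ ℚ.+_) (X-*-zero (# 4 * [1+4X]⁻¹))
[1+4X]⁻¹-telescope (suc n) = trans
  (cong ([1+4X]⁻¹ (suc n) ℚ.+_) (trans (X-*-suc (# 4 * [1+4X]⁻¹) n) (con-* (ι 4) [1+4X]⁻¹ n)))
  (solve 1 (λ e → const (ℚ.- ι 4) :* e :+ const (ι 4) :* e := const 0ℚ) refl ([1+4X]⁻¹ n))
  where open ℚSolver

[1+4X]*[1+4X]⁻¹ : (# 1 + # 4 * X) * [1+4X]⁻¹ ≈ # 1
[1+4X]*[1+4X]⁻¹ = ≈-trans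
  (solve 2 (λ x e → (const (ι 1) :+ const (ι 4) :* x) :* e := e :+ x :* (const (ι 4) :* e)) ≈-refl X [1+4X]⁻¹)
  [1+4X]⁻¹-telescope
  where open SeriesSolver

θ√g : θ √g ≈ X * (# 32 * θ √g - # 16 * √g)
θ√g zero    = sym (X-*-zero (# 32 * θ √g - # 16 * √g))
θ√g (suc n) = trans
  (reciprocal-multiple (suc n) ((ι 32 ℚ.* ι n ℚ.- ι 16) ℚ.* √g n))
  (sym (trans (X-*-suc (# 32 * θ √g - # 16 * √g) n) (trans
    (cong₂ ℚ._-_ (con-* (ι 32) (θ √g) n) (con-* (ι 16) √g n))
    (solve 2 (λ m s →
      const (ι 32) :* (m :* s) :- const (ι 16) :* s := (const (ι 32) :* m :- const (ι 16)) :* s)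
      refl (ι n) (√g n)))))
  where open ℚSolver

-- The equation reads (1 - 32x) θf = -32x f, which `g` and the square of `√g` both satisfy; their
-- difference has value 0 at the origin.
first-order-unique : ∀ f → f 0 ≡ 0ℚ → θ f ≈ X * (# 32 * θ f - # 32 * f) → f ≈ # 0
first-order-unique f f₀≡0 equation zero    = f₀≡0
first-order-unique f f₀≡0 equation (suc n) = ι-cancel (suc n) (begin
  ι (suc n) ℚ.* f (suc n)
    ≡⟨ equation (suc n) ⟩
  (X * (# 32 * θ f - # 32 * f)) (suc n)
    ≡⟨ X-*-suc (# 32 * θ f - # 32 * f) n ⟩
  (# 32 * θ f) n ℚ.- (# 32 * f) n
    ≡⟨ cong₂ ℚ._-_ (con-* (ι 32) (θ f) n) (con-* (ι 32) f n) ⟩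
  ι 32 ℚ.* (ι n ℚ.* f n) ℚ.- ι 32 ℚ.* f n
    ≡⟨ cong (λ q → ι 32 ℚ.* (ι n ℚ.* q) ℚ.- ι 32 ℚ.* q)
         (trans (first-order-unique f f₀≡0 equation n) (#0≡0 n)) ⟩
  ι 32 ℚ.* (ι n ℚ.* 0ℚ) ℚ.- ι 32 ℚ.* 0ℚ
    ≡⟨ solve 2 (λ m N → const (ι 32) :* (m :* const 0ℚ) :- const (ι 32) :* const 0ℚ := N :* const 0ℚ)
         refl (ι n) (ι (suc n)) ⟩
  ι (suc n) ℚ.* 0ℚ ∎)
  where
  open ≡-Reasoning
  open ℚSolver

√g-squared : √g ^ 2 ≈ g
√g-squared = begin
  √g ^ 2       ≈⟨ solve 2 (λ s x → s :^ 2 := (s :^ 2 :- (const (ι 1) :- const (ι 32) :* x))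
                    :+ (const (ι 1) :- const (ι 32) :* x)) ≈-refl √g X ⟩
  defect + g   ≈⟨ +-congʳ {g} (first-order-unique defect refl equation) ⟩
  # 0 + g      ≈⟨ +-identityˡ g ⟩
  g            ∎
  where
  open SeriesSolver
  open import Relation.Binary.Reasoning.Setoid setoid
  defect : Series
  defect = √g ^ 2 - g
  θ-defect : θ defect ≈ # 2 * √g * θ √g + # 32 * X
  θ-defect = differentiate θ-isDerivation (v 0 ∷ v 2 ∷ []) (v 1 ∷ v 2 ∷ []) (√g ∷ X ∷ []) (√g ∷ θ √g ∷ X ∷ [])
    (≈-refl ∷ ≈-refl ∷ []) (≈-refl ∷ θX ∷ [])
    (v 0 :^ 2 :- (const (ι 1) :- const (ι 32) :* v 1)) (const (ι 2) :* v 0 :* v 1 :+ const (ι 32) :* v 2) ≈-refl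
  equation : θ defect ≈ X * (# 32 * θ defect - # 32 * defect)
  equation = begin
    θ defect
      ≈⟨ θ-defect ⟩
    # 2 * √g * θ √g + # 32 * X
      ≈⟨ +-congʳ {# 32 * X} (*-congˡ {# 2 * √g} θ√g) ⟩
    # 2 * √g * (X * (# 32 * θ √g - # 16 * √g)) + # 32 * X
      ≈⟨ solve 3 (λ s s₁ x →
           const (ι 2) :* s :* (x :* (const (ι 32) :* s₁ :- const (ι 16) :* s)) :+ const (ι 32) :* x :=
           x :* (const (ι 32) :* (const (ι 2) :* s :* s₁ :+ const (ι 32) :* x)
             :- const (ι 32) :* (s :^ 2 :- (const (ι 1) :- const (ι 32) :* x)))) ≈-refl √g (θ √g) X ⟩
    X * (# 32 * (# 2 * √g * θ √g + # 32 * X) - # 32 * defect)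
      ≈⟨ *-congˡ {X} (+-congʳ {neg (# 32 * defect)} (*-congˡ {# 32} (≈-sym {θ defect} θ-defect))) ⟩
    X * (# 32 * θ defect - # 32 * defect) ∎

-- One branch σ of the square root of 1 - 32x

module Branch (σ : Series) (σ² : σ ^ 2 ≈ g) where
  open SeriesSolver
  open import Relation.Binary.Reasoning.Setoid setoid
  private
    module D = IsDerivation θ-isDerivation

  -- `P` is 2/(3 - σ) with its denominator rationalised, 9 - σ² = 8(1 + 4x). Thus the inverse of 1 +
  -- 4x is the only inverse series required, for either sign of σ.
  κ r P : Series
  κ = con (+ 1 / 2) * (# 1 - σ)
  r = # 1 + κ
  P = con (+ 1 / 4) * (# 3 + σ) * [1+4X]⁻¹

  κ-κ² : κ - κ ^ 2 ≈ # 8 * X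
  κ-κ² = begin
    κ - κ ^ 2
      ≈⟨ solve 1 (λ s → let k = const (+ 1 / 2) :* (const (ι 1) :- s) in
           k :- k :^ 2 := const (+ 1 / 4) :* (const (ι 1) :- s :^ 2)) ≈-refl σ ⟩
    con (+ 1 / 4) * (# 1 - σ ^ 2)
      ≈⟨ *-congˡ {con (+ 1 / 4)} (+-congˡ {# 1} (-‿cong σ²)) ⟩
    con (+ 1 / 4) * (# 1 - g)
      ≈⟨ solve 1 (λ x → const (+ 1 / 4) :* (const (ι 1) :- (const (ι 1) :- const (ι 32) :* x)) := const (ι 8) :* x) ≈-refl X ⟩
    # 8 * X ∎

  -- Differentiating σ² = g: multiplying `θ σ` by σ makes it polynomial in x, which is why the
  -- derivation σθ acts rationally on κ.
  σθσ : # 2 * σ * θ σ ≈ neg (# 32 * X)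
  σθσ = begin
    # 2 * σ * θ σ
      ≈⟨ differentiate θ-isDerivation (v 0 ∷ []) (v 1 ∷ []) (σ ∷ []) (σ ∷ θ σ ∷ []) (≈-refl ∷ []) (≈-refl ∷ [])
           (v 0 :^ 2) (const (ι 2) :* v 0 :* v 1) ≈-refl ⟨
    θ (σ ^ 2)
      ≈⟨ D.D-cong {σ ^ 2} σ² ⟩
    θ g
      ≈⟨ differentiate θ-isDerivation (v 0 ∷ []) (v 0 ∷ []) (X ∷ []) (X ∷ []) (≈-refl ∷ []) (θX ∷ [])
           (const (ι 1) :- const (ι 32) :* v 0) (:- (const (ι 32) :* v 0)) ≈-refl ⟩
    neg (# 32 * X) ∎

  ∂κ : scaled σ θ κ ≈ κ - κ ^ 2
  ∂κ = begin
    σ * θ κ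
      ≈⟨ *-congˡ {σ} (differentiate θ-isDerivation (v 0 ∷ []) (v 1 ∷ []) (σ ∷ []) (σ ∷ θ σ ∷ []) (≈-refl ∷ []) (≈-refl ∷ [])
           (const (+ 1 / 2) :* (const (ι 1) :- v 0)) (const (ℚ.- (+ 1 / 2)) :* v 1) ≈-refl) ⟩
    σ * (con (ℚ.- (+ 1 / 2)) * θ σ)
      ≈⟨ solve 2 (λ s s₁ → s :* (const (ℚ.- (+ 1 / 2)) :* s₁) := const (ℚ.- (+ 1 / 4)) :* (const (ι 2) :* s :* s₁))
           ≈-refl σ (θ σ) ⟩
    con (ℚ.- (+ 1 / 4)) * (# 2 * σ * θ σ)
      ≈⟨ *-congˡ {con (ℚ.- (+ 1 / 4))} σθσ ⟩
    con (ℚ.- (+ 1 / 4)) * neg (# 32 * X)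
      ≈⟨ solve 1 (λ x → const (ℚ.- (+ 1 / 4)) :* (:- (const (ι 32) :* x)) := const (ι 8) :* x) ≈-refl X ⟩
    # 8 * X
      ≈⟨ κ-κ² ⟨
    κ - κ ^ 2 ∎

  P-inverse : (# 1 + κ) * P ≈ # 1
  P-inverse = begin
    (# 1 + κ) * P
      ≈⟨ solve 2 (λ s e → (const (ι 1) :+ const (+ 1 / 2) :* (const (ι 1) :- s)) :* (const (+ 1 / 4) :* (const (ι 3) :+ s) :* e) :=
           const (+ 1 / 8) :* (const (ι 9) :- s :^ 2) :* e) ≈-refl σ [1+4X]⁻¹ ⟩
    con (+ 1 / 8) * (# 9 - σ ^ 2) * [1+4X]⁻¹
      ≈⟨ *-congʳ {[1+4X]⁻¹} (*-congˡ {con (+ 1 / 8)} (+-congˡ {# 9} (-‿cong σ²))) ⟩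
    con (+ 1 / 8) * (# 9 - g) * [1+4X]⁻¹
      ≈⟨ solve 2 (λ x e → const (+ 1 / 8) :* (const (ι 9) :- (const (ι 1) :- const (ι 32) :* x)) :* e :=
           (const (ι 1) :+ const (ι 4) :* x) :* e) ≈-refl X [1+4X]⁻¹ ⟩
    (# 1 + # 4 * X) * [1+4X]⁻¹
      ≈⟨ [1+4X]*[1+4X]⁻¹ ⟩
    # 1 ∎

  open Transformation (scaled-isDerivation θ-isDerivation σ) κ P ∂κ P-inverse public
    using (y; τ; V; h; ∂y; quadratic-transformed)

  -- Modulo 8x = κ - κ² the denominator c - dσ equals κ(1 + κ)³/4. Its product with `y` is (κ -
  -- κ²)²((1 + κ)P)³/32 = (8x)²/32. `cofactor` comes from dividing by 8x - (κ - κ²).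
  y-quotient : y * (c - d * σ) ≈ # 2 * X ^ 2
  y-quotient = begin
    y * (c - d * σ)
      ≈⟨ *-congˡ {y} (solve 2 (λ s x → let k = const (+ 1 / 2) :* (const (ι 1) :- s) in
           const (ι 1) :- const (ι 19) :* x :+ const (ι 16) :* x :^ 2 :- (const (ι 1) :- const (ι 5) :* x) :* s :=
           const (+ 1 / 4) :* k :* (const (ι 1) :+ k) :^ 3 :+ const (+ 1 / 8) :* (const (ι 8) :* x :- (k :- k :^ 2)) :*
             (const (ι 16) :* x :+ const (ι 2) :* (k :- k :^ 2) :- const (ι 14) :- const (ι 10) :* k))
           ≈-refl σ X) ⟩
    y * (con (+ 1 / 4) * κ * (# 1 + κ) ^ 3 + con (+ 1 / 8) * (# 8 * X - (κ - κ ^ 2)) * cofactor)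
      ≈⟨ *-congˡ {y} (+-congˡ {con (+ 1 / 4) * κ * (# 1 + κ) ^ 3} (*-congʳ {cofactor} (*-congˡ {con (+ 1 / 8)}
           (+-congˡ {# 8 * X} (-‿cong κ-κ²))))) ⟩
    y * (con (+ 1 / 4) * κ * (# 1 + κ) ^ 3 + con (+ 1 / 8) * (# 8 * X - # 8 * X) * cofactor)
      ≈⟨ solve 4 (λ k p x q →
           const (+ 1 / 8) :* k :* (const (ι 1) :- k) :^ 2 :* p :^ 3 :*
             (const (+ 1 / 4) :* k :* (const (ι 1) :+ k) :^ 3 :+ const (+ 1 / 8) :* (const (ι 8) :* x :- const (ι 8) :* x) :* q) :=
           const (+ 1 / 32) :* (k :- k :^ 2) :^ 2 :* ((const (ι 1) :+ k) :* p) :^ 3) ≈-refl κ P X cofactor ⟩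
    con (+ 1 / 32) * (κ - κ ^ 2) ^ 2 * ((# 1 + κ) * P) ^ 3
      ≈⟨ *-cong (*-congˡ {con (+ 1 / 32)} (^-cong 2 κ-κ²)) (^-cong 3 P-inverse) ⟩
    con (+ 1 / 32) * (# 8 * X) ^ 2 * (# 1) ^ 3
      ≈⟨ solve 1 (λ x → const (+ 1 / 32) :* (const (ι 8) :* x) :^ 2 :* const (ι 1) :^ 3 := const (ι 2) :* x :^ 2) ≈-refl X ⟩
    # 2 * X ^ 2 ∎
    where
    cofactor : Series
    cofactor = # 16 * X + # 2 * (κ - κ ^ 2) - # 14 - # 10 * κ
    ^-cong : ∀ k {f h} → f ≈ h → f ^ k ≈ h ^ k
    ^-cong zero    f≈h = ≈-refl
    ^-cong (suc k) f≈h = *-cong f≈h (^-cong k f≈h)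

  r-root : r ^ 2 ≈ a - b * σ
  r-root = begin
    r ^ 2
      ≈⟨ solve 1 (λ s → (const (ι 1) :+ const (+ 1 / 2) :* (const (ι 1) :- s)) :^ 2 :=
           const (+ 9 / 4) :- const (+ 3 / 2) :* s :+ const (+ 1 / 4) :* s :^ 2) ≈-refl σ ⟩
    con (+ 9 / 4) - con (+ 3 / 2) * σ + con (+ 1 / 4) * σ ^ 2
      ≈⟨ +-congˡ {con (+ 9 / 4) - con (+ 3 / 2) * σ} (*-congˡ {con (+ 1 / 4)} σ²) ⟩
    con (+ 9 / 4) - con (+ 3 / 2) * σ + con (+ 1 / 4) * g
      ≈⟨ solve 2 (λ s x → const (+ 9 / 4) :- const (+ 3 / 2) :* s :+ const (+ 1 / 4) :* (const (ι 1) :- const (ι 32) :* x) :=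
           const (+ 5 / 2) :- const (ι 8) :* x :- const (+ 3 / 2) :* s) ≈-refl σ X ⟩
    a - b * σ ∎

  leading-scaled : V * σ ^ 2 ≈ W₆
  leading-scaled = begin
    V * σ ^ 2
      ≈⟨ *-cong (+-congˡ {# 1} (*-congˡ {con (+ 1 / 2)} κ-κ²)) σ² ⟩
    (# 1 + con (+ 1 / 2) * (# 8 * X)) * g
      ≈⟨ solve 1 (λ x → (const (ι 1) :+ const (+ 1 / 2) :* (const (ι 8) :* x)) :* (const (ι 1) :- const (ι 32) :* x) :=
           const (ι 1) :+ const (gs 1) :* x :+ const (gs 2) :* x :^ 2) ≈-refl X ⟩
    W₆ ∎

  potential-scaled : h ≈ H₆
  potential-scaled = begin
    h
      ≈⟨ *-cong κ-κ² (+-congˡ {# 1} (*-congˡ {con (+ 3 / 2)} κ-κ²)) ⟩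
    # 8 * X * (# 1 + con (+ 3 / 2) * (# 8 * X))
      ≈⟨ solve 1 (λ x → const (ι 8) :* x :* (const (ι 1) :+ const (+ 3 / 2) :* (const (ι 8) :* x)) :=
           const (hs 1) :* x :+ const (hs 2) :* x :^ 2) ≈-refl X ⟩
    H₆ ∎

  P-convergent : Convergent σ → Convergent P
  P-convergent σ-convergent = convergent-*
    (convergent-* (convergent-con (+ 1 / 4)) (convergent-+ (convergent-con (ι 3)) σ-convergent))
    (1 , 4 , ∣[1+4X]⁻¹∣≤)

  κ-convergent : Convergent σ → Convergent κ
  κ-convergent σ-convergent = convergent-* (convergent-con (+ 1 / 2)) (convergent-minus (convergent-con 1ℚ) σ-convergent)

  y-convergent : Convergent σ → Convergent y
  y-convergent σ-convergent = convergent-*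
    (convergent-* (convergent-* (convergent-con (+ 1 / 8)) (κ-convergent σ-convergent))
      (convergent-^ 2 (convergent-minus (convergent-con 1ℚ) (κ-convergent σ-convergent))))
    (convergent-^ 3 (P-convergent σ-convergent))

  module _ (y₀≡0 : y 0 ≡ 0ℚ) where
    open Composition y y₀≡0

    -- Once θW₃ is written as -108x, Q₃(F₃) = 0 is a polynomial relation between x, F₃, θF₃ and
    -- θ²F₃; composition with `y` is a ring homomorphism and preserves it.
    F₃∘y-quadratic : let G = λ f → f ∘ y in
      # 2 * G F₃ * (# 2 * (# 1 - # 108 * y) * G (θ (θ F₃)) + neg (# 108 * y) * G (θ F₃))
        - # 2 * (# 1 - # 108 * y) * G (θ F₃) ^ 2 + neg (# 48 * y) * G F₃ ^ 2 ≈ # 0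
    F₃∘y-quadratic = begin
      _
        ≈⟨ ∘-polynomial {ρ = X ∷ F₃ ∷ θ F₃ ∷ θ (θ F₃) ∷ []}
             (∘-X ∷ ≈-refl ∷ ≈-refl ∷ ≈-refl ∷ []) p ⟨
      ⟦ p ⟧ (X ∷ F₃ ∷ θ F₃ ∷ θ (θ F₃) ∷ []) ∘ y
        ≈⟨ ∘-cong p≈0 ⟩
      # 0 ∘ y
        ≈⟨ ∘-con 0ℚ ⟩
      # 0 ∎
      where
      p : Polynomial 4
      p = const (ι 2) :* v 1 :* (const (ι 2) :* (const (ι 1) :- const (ι 108) :* v 0) :* v 3
            :+ :- (const (ι 108) :* v 0) :* v 2)
          :- const (ι 2) :* (const (ι 1) :- const (ι 108) :* v 0) :* v 2 :^ 2
          :+ :- (const (ι 48) :* v 0) :* v 1 :^ 2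
      p≈0 : ⟦ p ⟧ (X ∷ F₃ ∷ θ F₃ ∷ θ (θ F₃) ∷ []) ≈ # 0
      p≈0 = begin
        ⟦ p ⟧ (X ∷ F₃ ∷ θ F₃ ∷ θ (θ F₃) ∷ [])
          ≈⟨ prove (X ∷ F₃ ∷ θ F₃ ∷ θ (θ F₃) ∷ []) p
               (const (ι 2) :* v 1 :* (const (ι 2) :* W :* v 3 :+ W₁ :* v 2)
                 :- const (ι 2) :* W :* v 2 :^ 2 :- const (ι 2) :* H :* v 1 :^ 2) ≈-refl ⟩
        # 2 * F₃ * (# 2 * W₃ * θ (θ F₃) + (con (ℚ.- ι 108) * X + # 2 * con 0ℚ * X ^ 2) * θ F₃)
          - # 2 * W₃ * θ F₃ ^ 2 - # 2 * H₃ * F₃ ^ 2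
          ≈⟨ +-congʳ {neg (# 2 * H₃ * F₃ ^ 2)} (+-congʳ {neg (# 2 * W₃ * θ F₃ ^ 2)} (*-congˡ {# 2 * F₃}
               (+-congˡ {# 2 * W₃ * θ (θ F₃)} (*-congʳ {θ F₃} (θ-leading (ℚ.- ι 108) 0ℚ (ι 24) 0ℚ))))) ⟨
        quadratic θ W₃ H₃ F₃
          ≈⟨ F₃-quadratic ⟩
        # 0 ∎
        where
        W W₁ H : Polynomial 4
        W  = const (ι 1) :+ const (ℚ.- ι 108) :* v 0 :+ const 0ℚ :* v 0 :^ 2
        W₁ = const (ℚ.- ι 108) :* v 0 :+ const (ι 2) :* const 0ℚ :* v 0 :^ 2
        H  = const (ι 24) :* v 0 :+ const 0ℚ :* v 0 :^ 2

    private
      F : Series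
      F = P * (F₃ ∘ y)

    F-quadratic : quadratic θ W₆ H₆ F ≈ # 0
    F-quadratic = begin
      quadratic θ W₆ H₆ F
        ≈⟨ quadratic-cong θ-isDerivation F leading-scaled potential-scaled ⟨
      quadratic θ (V * σ ^ 2) h F
        ≈⟨ quadratic-scaled θ-isDerivation σ V h F ⟩
      quadratic (scaled σ θ) V h F
        ≈⟨ quadratic-transformed (scaled-θ-∘ σ τ ∂y F₃) (scaled-θ-∘ σ τ ∂y (θ F₃)) ⟩
      _
        ≈⟨ F₃∘y-quadratic ⟩
      # 0 ∎

    P*F₃∘y≡F₆ : (# 2 * F) 0 ≢ 0ℚ → ∀ n → F n ≡ F 0 ℚ.* F₆ n
    P*F₃∘y≡F₆ F₀≢0 = F₆-unique F (*-cancelˡ-zero (# 2 * F) F₀≢0 (begin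
      # 2 * F * linear θ W₆ H₆ F
        ≈⟨ quadratic-integral θ-isDerivation W₆ H₆ F ⟨
      θ (quadratic θ W₆ H₆ F)
        ≈⟨ D.D-cong {quadratic θ W₆ H₆ F} F-quadratic ⟩
      θ (# 0)
        ≈⟨ D.D-C 0ℚ ⟩
      # 0 ∎))

-- The two branches and the theorem

module B⁻ = Branch √g √g-squared
neg-√g-squared : neg √g ^ 2 ≈ g
neg-√g-squared = ≈-trans (solve 1 (λ s → (:- s) :^ 2 := s :^ 2) ≈-refl √g) √g-squared
  where open SeriesSolver

-- With σ = -√g one has κ(0) = 1, so the factor (1 - κ)² gives `y` its double zero and P(0) = 1/2;
-- with σ = √g the simple zero comes from κ itself and P(0) = 1.
module B⁺ = Branch (neg √g) neg-√g-squared

minus-neg : ∀ f h k → f - h * neg k ≈ f + h * k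
minus-neg = solve 3 (λ f h k → f :- h :* (:- k) := f :+ h :* k) ≈-refl
  where open SeriesSolver

√g-convergent : Convergent √g
√g-convergent = 1 , 32 , ∣√g∣≤

1+4X-convergent : Convergent (# 1 + # 4 * X)
1+4X-convergent = convergent-+ (convergent-con 1ℚ) (convergent-* (convergent-con (ι 4)) convergent-X)

F₃-convergent : Convergent F₃
F₃-convergent = 1 , 360 , λ n → subst (ℚ._≤ ι (1 ℕ.* 360 ℕ.^ n)) (sym (∣ι∣ (t₃ n)))
  (ι-mono-≤ {t₃ n} {1 ℕ.* 360 ℕ.^ n} (t₃≤360^ n))

-- The norm of c - dσ = κ(1 + κ)³/4 under κ ↦ 1 - κ: the product of 1 + κ with its conjugate 2 - κ
-- is 2(1 + 4x). The same product, squared, lies behind `v-quotient`.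
u-quotient : (# 1 + # 4 * X) ^ 3 * (# 4 * X) ≈ c ^ 2 - d ^ 2 * g
u-quotient = solve 1 (λ x →
  (const (ι 1) :+ const (ι 4) :* x) :^ 3 :* (const (ι 4) :* x) :=
  (const (ι 1) :- const (ι 19) :* x :+ const (ι 16) :* x :^ 2) :^ 2
    :- (const (ι 1) :- const (ι 5) :* x) :^ 2 :* (const (ι 1) :- const (ι 32) :* x)) ≈-refl X
  where open SeriesSolver

v-quotient : (# 1 + # 4 * X) ^ 2 * # 4 ≈ a ^ 2 - b ^ 2 * g
v-quotient = solve 1 (λ x →
  (const (ι 1) :+ const (ι 4) :* x) :^ 2 :* const (ι 4) :=
  (const (+ 5 / 2) :- const (ι 8) :* x) :^ 2 :- const (+ 3 / 2) :^ 2 :* (const (ι 1) :- const (ι 32) :* x)) ≈-refl X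
  where open SeriesSolver

y⁻-leading : B⁻.y ≈ X modX^ 2
y⁻-leading 0 _ = refl
y⁻-leading 1 _ = refl
y⁻-leading (suc (suc n)) (s≤s (s≤s ()))

y⁺-leading : B⁺.y ≈ X ^ 2 modX^ 3
y⁺-leading 0 _ = refl
y⁺-leading 1 _ = refl
y⁺-leading 2 _ = refl
y⁺-leading (suc (suc (suc n))) (s≤s (s≤s (s≤s ())))

F₆≈F₃∘y⁻ : F₆ ≈ B⁻.P * (F₃ ∘ B⁻.y)
-- Constant terms are settled by computation: `refl` shows that `y` vanishes at 0, the absurd
-- pattern that 2F does not, and F(0) = 1 makes the multiple of F₆ trivial.
F₆≈F₃∘y⁻ n = sym (trans (B⁻.P*F₃∘y≡F₆ refl (λ ()) n) (ℚ.*-identityˡ (T₆ n)))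

F₆≈F₃∘y⁺ : F₆ ≈ # 2 * B⁺.P * (F₃ ∘ B⁺.y)
F₆≈F₃∘y⁺ n = sym (begin
  (# 2 * B⁺.P * (F₃ ∘ B⁺.y)) n        ≡⟨ *-assoc (# 2) B⁺.P (F₃ ∘ B⁺.y) n ⟩
  (# 2 * (B⁺.P * (F₃ ∘ B⁺.y))) n      ≡⟨ con-* (ι 2) (B⁺.P * (F₃ ∘ B⁺.y)) n ⟩
  ι 2 ℚ.* (B⁺.P * (F₃ ∘ B⁺.y)) n      ≡⟨ cong (ι 2 ℚ.*_) (B⁺.P*F₃∘y≡F₆ refl (λ ()) n) ⟩
  -- Here 1/2 is the computed constant term of `B⁺.P * (F₃ ∘ B⁺.y)`.
  ι 2 ℚ.* ((+ 1 / 2) ℚ.* T₆ n)        ≡⟨ solve 1 (λ t → const (ι 2) :* (const (+ 1 / 2) :* t) := t) refl (T₆ n) ⟩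
  T₆ n                                ∎)
  where
  open ≡-Reasoning
  open ℚSolver

theorem8p1 : Convergent F₃ × Convergent F₆ ×
    (∃[ u ] IsQuotient (c ^ 2 - d ^ 2 * g) (# 4 * X) u × IsRoot 3 u (# 1 + # 4 * X)) ×
    (∃[ v ] IsQuotient (a ^ 2 - b ^ 2 * g) (# 4) v × IsRoot 2 v (# 1 + # 4 * X)) ×
    (∃[ √g ] IsRoot 2 g √g ×
    (∃[ y⁺ ] ∃[ y⁻ ]
    IsQuotient (# 2 * X ^ 2) (c + d * √g) y⁺ ×
    IsQuotient (# 2 * X ^ 2) (c - d * √g) y⁻ ×
    (y⁺ ≈ X ^ 2 modX^ 3) × (y⁻ ≈ X modX^ 2) ×
    (∃[ r⁺ ] ∃[ p⁺ ]
    IsRoot 2 (a + b * √g) r⁺ × IsQuotient (# 2) r⁺ p⁺ ×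
    (F₆ ≈ p⁺ * (F₃ ∘ y⁺))) ×
    (∃[ r⁻ ] ∃[ p⁻ ]
    IsRoot 2 (a - b * √g) r⁻ × IsQuotient (# 1) r⁻ p⁻ ×
    (F₆ ≈ p⁻ * (F₃ ∘ y⁻)))))
theorem8p1 =
  F₃-convergent ,
  (1 , 32 , ∣T₆∣≤) ,
  ((# 1 + # 4 * X) ^ 3 ,
    (convergent-^ 3 1+4X-convergent , (1 , λ ()) , u-quotient) ,
    (1+4X-convergent , (λ _ → refl) , toWitness {a? = 0ℚ ℚ.<? 1ℚ} _)) ,
  ((# 1 + # 4 * X) ^ 2 ,
    (convergent-^ 2 1+4X-convergent , (0 , λ ()) , v-quotient) ,
    (1+4X-convergent , (λ _ → refl) , toWitness {a? = 0ℚ ℚ.<? 1ℚ} _)) ,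
  √g , (√g-convergent , √g-squared , toWitness {a? = 0ℚ ℚ.<? 1ℚ} _) ,
  B⁺.y , B⁻.y ,
  (B⁺.y-convergent -√g-convergent , (0 , λ ()) ,
    ≈-trans (*-congˡ {B⁺.y} (≈-sym {c - d * neg √g} (minus-neg c d √g))) B⁺.y-quotient) ,
  -- The denominator c - d√g is 2x + O(x²), so it is coefficient 1 that witnesses that it is
  -- nonzero, whereas c + d√g is already nonzero at the origin.
  (B⁻.y-convergent √g-convergent , (1 , λ ()) , B⁻.y-quotient) ,
  y⁺-leading , y⁻-leading ,
  (B⁺.r , # 2 * B⁺.P ,
    (convergent-+ (convergent-con 1ℚ) (B⁺.κ-convergent -√g-convergent) ,
      ≈-trans B⁺.r-root (minus-neg a b √g) , toWitness {a? = 0ℚ ℚ.<? B⁺.r 0} _) ,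
    (convergent-* (convergent-con (ι 2)) (B⁺.P-convergent -√g-convergent) , (0 , λ ()) , p⁺-quotient) ,
    F₆≈F₃∘y⁺) ,
  (B⁻.r , B⁻.P ,
    (convergent-+ (convergent-con 1ℚ) (B⁻.κ-convergent √g-convergent) ,
      B⁻.r-root , toWitness {a? = 0ℚ ℚ.<? B⁻.r 0} _) ,
    (B⁻.P-convergent √g-convergent , (0 , λ ()) ,
      ≈-trans (*-comm B⁻.P B⁻.r) B⁻.P-inverse) ,
    F₆≈F₃∘y⁻)
  where
  -√g-convergent : Convergent (neg √g)
  -√g-convergent = convergent-neg √g-convergent
  p⁺-quotient : # 2 * B⁺.P * B⁺.r ≈ # 2
  p⁺-quotient = ≈-trans (*-assoc (# 2) B⁺.P B⁺.r)
    (≈-trans (*-congˡ {# 2} (≈-trans (*-comm B⁺.P B⁺.r) B⁺.P-inverse)) (*-identityʳ (# 2)))
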